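{- For every $n\ge 1$ there exists an involution $\Phi$ on $\mathfrak{S}_n(2413,3142)$ such that for every $\pi\in\mathfrak{S}_n(2413,3142)$, $$\mathrm{LMAX}(\Phi(\pi))=\mathrm{LMAX}(\pi),\quad \mathrm{LMIN}(\Phi(\pi))=\mathrm{LMIN}(\pi),\quad \mathrm{DESB}(\Phi(\pi))=\mathrm{DESB}(\pi),$$ $$\mathsf{comp}(\Phi(\pi))=\mathsf{iar}(\pi),\qquad \mathsf{iar}(\Phi(\pi))=\mathsf{comp}(\pi).$$ Moreover, $\Phi$ maps $\mathfrak{S}_n(312)$ to itself, hence restricts to an involution on $\mathfrak{S}_n(312)$.
   Context: $\mathfrak{S}_n$ is the set of permutations $\pi=\pi_1\pi_2\cdots\pi_n$ of $[n]=\{1,\dots,n\}$. A permutation $\pi$ avoids a pattern $\sigma\in\mathfrak{S}_k$ if no subsequence of $\pi$ is order-isomorphic to $\sigma$; $\mathfrak{S}_n(P)$ denotes the set of permutations in $\mathfrak{S}_n$ avoiding every pattern in the set $P$. For $\pi\in\mathfrak{S}_n$ define: $\mathrm{LMAX}(\pi)=\{\pi_i: \pi_j<\pi_i \text{ for all } 1\le j<i\}$ (values of left-to-right maxima); $\mathrm{LMIN}(\pi)=\{\pi_i: \pi_j>\pi_i \text{ for all } 1\le j<i\}$ (values of left-to-right minima); $\mathrm{DES}(\pi)=\{i\in[n-1]: \pi_i>\pi_{i+1}\}$ (descent positions); $\mathrm{DESB}(\pi)=\{\pi_{i+1}: i\in \mathrm{DES}(\pi)\}$ (descent bottoms); $\mathsf{iar}(\pi)=\min(\mathrm{DES}(\pi)\cup\{n\})$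 (length of the initial ascending run); $\mathsf{comp}(\pi)=|\{i\in[n]: \pi_j\le i \text{ for all } j\le i\}|$ (number of components). -}

module Defs where

open import Data.Nat using (ℕ; zero; suc; _<_; _≤_; _<ᵇ_; _≤?_)
open import Data.Fin using (Fin; toℕ; #_)
open import Data.Fin.Properties using (all?)
open import Data.List using (List; []; _∷_; length; filter; tabulate; allFin)
open import Data.Vec using (Vec; lookup) renaming (_∷_ to _∷ᵥ_; [] to []ᵥ)
open import Data.Product using (Σ; ∃; _×_; _,_)
open import Data.Bool using (if_then_else_)
open import Function using (_⇔_)
open import Function.Definitions using (Injective)
open import Relation.Binary.PropositionalEquality using (_≡_)
open import Relation.Nullary using (¬_)
open import Relation.Nullary.Decidable using (_→-dec_)

-- A permutation π = π_1 ⋯ π_n of [n] is represented 0-indexed as an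
-- injective map Fin n → Fin n : position i ↦ value π i (injective
-- endomaps of a finite set are exactly the bijections).
-- Position i ∈ Fin n stands for i+1 and value v stands for v+1.
Perm : ℕ → Set
Perm n = Fin n → Fin n

IsPerm : ∀ {n} → Perm n → Set
IsPerm π = Injective _≡_ _≡_ π

Contains : ∀ {n k} → Perm n → Perm k → Set
Contains {n} {k} π σ =
  Σ (Fin k → Fin n) λ f →
    (∀ a b → toℕ a < toℕ b → toℕ (f a) < toℕ (f b)) ×
    (∀ a b → (toℕ (σ a) < toℕ (σ b)) ⇔ (toℕ (π (f a)) < toℕ (π (f b))))

Avoids : ∀ {n k} → Perm n → Perm k → Set
Avoids π σ = ¬ Contains π σ

-- The patterns, written 0-indexed (2413 ↦ 1302, 3142 ↦ 2031, 312 ↦ 201).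
p2413 : Perm 4
p2413 = lookup (# 1 ∷ᵥ # 3 ∷ᵥ # 0 ∷ᵥ # 2 ∷ᵥ []ᵥ)

p3142 : Perm 4
p3142 = lookup (# 2 ∷ᵥ # 0 ∷ᵥ # 3 ∷ᵥ # 1 ∷ᵥ []ᵥ)

p312 : Perm 3
p312 = lookup (# 2 ∷ᵥ # 0 ∷ᵥ # 1 ∷ᵥ []ᵥ)

InSep : ∀ {n} → Perm n → Set
InSep π = IsPerm π × Avoids π p2413 × Avoids π p3142

In312 : ∀ {n} → Perm n → Set
In312 π = IsPerm π × Avoids π p312

InLMAX : ∀ {n} → Perm n → Fin n → Set
InLMAX π v = ∃ λ i → π i ≡ v × (∀ j → toℕ j < toℕ i → toℕ (π j) < toℕ (π i))

InLMIN : ∀ {n} → Perm n → Fin n → Set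
InLMIN π v = ∃ λ i → π i ≡ v × (∀ j → toℕ j < toℕ i → toℕ (π i) < toℕ (π j))

InDESB : ∀ {n} → Perm n → Fin n → Set
InDESB π v = ∃ λ i → ∃ λ j →
  toℕ j ≡ suc (toℕ i) × toℕ (π j) < toℕ (π i) × π j ≡ v

-- iar(π): length of the initial ascending run, i.e. min(DES(π) ∪ {n}).
iarList : List ℕ → ℕ
iarList [] = 0
iarList (x ∷ []) = 1
iarList (x ∷ y ∷ xs) = if x <ᵇ y then suc (iarList (y ∷ xs)) else 1

iar : ∀ {n} → Perm n → ℕ
iar {n} π = iarList (tabulate {n = n} (λ i → toℕ (π i)))

comp : ∀ {n} → Perm n → ℕ
comp {n} π = length (filter (λ i → all? (λ j → (toℕ j ≤? toℕ i) →-dec (toℕ (π j) ≤? toℕ i))) (allFin n))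

{-# OPTIONS --safe #-}
module Submission where

-- A separable permutation is a word of operations applied to the one-element permutation: each
-- letter is either ⊕ γ with γ sum-indecomposable or ⊖ β with β skew-indecomposable. Two letters
-- ⊕ γ and ⊖ β commute as far as LMAX, LMIN and DESB are concerned, so these only depend on the
-- sequence of the γ and the sequence of the β. If X is the sum of the ⊕-letters before the first
-- ⊖-letter and b is the number of ⊕-letters after the last one, then iar = 1 + iar X and
-- comp = 1 + b. By induction X may be replaced by Φ X, which turns iar X into the number of
-- components of Φ X, that is, into a number of ⊕-letters. Now reverse the pattern of ⊕ and ⊖ in
-- the word, keeping both sequences of letters, and apply Φ to the new initial sum: this exchanges
-- the two statistics and is an involution. A word without ⊖-letters is 1 ⊕ X and is sent to
-- 1 ⊕ Φ X. The permutation avoids 312 if and only if every β, also in the words of the γ, has one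
-- element, and this survives.

open import Defs
open import Data.Bool using (Bool; true; false; if_then_else_)
open import Data.Empty using (⊥; ⊥-elim)
open import Data.Fin as Fin using (Fin; zero; suc; toℕ; fromℕ<; #_)
import Data.Fin.Properties as Fin
open import Data.List as List using (List; []; _∷_; [_]; _++_; length; take; drop; tabulate; filter)
open import Data.List.Extrema.Nat using (max; xs≤max; max<v⁺)
open import Data.List.Membership.Propositional using (_∈_)
open import Data.List.Membership.Propositional.Properties using (∈-++⁺ˡ; ∈-++⁺ʳ; ∈-lookup)
import Data.List.Properties as List
open import Data.List.Relation.Binary.Sublist.Propositional
  using (_⊆_; []; _∷_; _∷ʳ_; from∈; to∈; minimum; ⊆-refl; ⊆-trans)
open import Data.List.Relation.Binary.Sublist.Propositional.Properties using (++⁺; ++⁺ˡ; ++⁺ʳ; All-resp-⊆)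
open import Data.List.Relation.Unary.All as All using (All; []; _∷_)
import Data.List.Relation.Unary.All.Properties as All
open import Data.List.Relation.Unary.AllPairs as AllPairs using (AllPairs; []; _∷_)
import Data.List.Relation.Unary.AllPairs.Properties as AllPairs
open import Data.List.Relation.Unary.Any using (here; there)
open import Data.Nat using (ℕ; zero; suc; _+_; _∸_; _≤_; _<_; _<ᵇ_; _⊔_; _≤?_; z≤n; s≤s)
open import Data.Nat.Properties
open import Data.Product using (Σ; ∃; ∃₂; _×_; _,_; proj₁; proj₂)
open import Data.Sum using (_⊎_; inj₁; inj₂)
open import Data.Unit using (⊤; tt)
open import Data.Vec as Vec using (Vec; []; _∷_; reverse; last; head; sum)
import Data.Vec.Properties as Vec
open import Data.Vec.Relation.Unary.All as VAll using ([]; _∷_)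
open import Function using (_∘_; id; _⇔_; mk⇔; Equivalence)
open import Relation.Binary.Definitions using (tri<; tri≈; tri>)
open import Relation.Binary.PropositionalEquality hiding ([_])
open import Relation.Nullary using (¬_; Dec; yes; no; does)
open import Relation.Nullary.Decidable using (dec-true; dec-false)
open import Relation.Unary using (Decidable)
open Equivalence using (to; from)

-- Trees, forests and spines of separable permutations

data Op : Set where
  ⊕ ⊖ : Op

-- The right child of an `o`-node is never an `o`-node: it is always the last summand that is split
-- off, which leaves one tree for each separable permutation. The proof of this is irrelevant, so it
-- does not enter into equality of trees.
mutual
  data Tree : Set where
    leaf : Tree
    node : (o : Op) (l r : Tree) → .(Indec o r) → Tree

  Indec : Op → Tree → Set
  Indec _ leaf             = ⊤
  Indec ⊕ (node ⊕ _ _ _) = ⊥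
  Indec ⊕ (node ⊖ _ _ _) = ⊤
  Indec ⊖ (node ⊕ _ _ _) = ⊤
  Indec ⊖ (node ⊖ _ _ _) = ⊥

record Ind (o : Op) : Set where
  constructor ind
  field
    tree   : Tree
    .indec : Indec o tree

Forest : Set
Forest = List (Ind ⊕)

addAll : Tree → Forest → Tree
addAll t []       = t
addAll t (ind r i ∷ cs) = addAll (node ⊕ t r i) cs

-- Sums are nested to the left, so the last component is met first; the accumulator holds the
-- components to the right of the tree.
comps : Tree → Forest → Forest
comps leaf           cs = ind leaf _ ∷ cs
comps (node ⊕ l r i) cs = comps l (ind r i ∷ cs)
comps (node ⊖ l r i) cs = ind (node ⊖ l r i) _ ∷ cs

comps-addAll : ∀ t cs ds → comps (addAll t cs) ds ≡ comps t (cs ++ ds)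
comps-addAll t []       ds = refl
comps-addAll t (ind r i ∷ cs) ds = comps-addAll (node ⊕ t r i) cs ds

comps-indec : ∀ t .(i : Indec ⊕ t) cs → comps t cs ≡ ind t i ∷ cs
comps-indec leaf           i cs = refl
comps-indec (node ⊖ l r _) i cs = refl

sumOf : Forest → Tree
-- A default value: no tree is an empty sum.
sumOf []       = leaf
sumOf (ind t _ ∷ cs) = addAll t cs

sumOf-comps : ∀ t cs → sumOf (comps t cs) ≡ addAll t cs
sumOf-comps leaf           cs = refl
sumOf-comps (node ⊕ l r i) cs = sumOf-comps l (ind r i ∷ cs)
sumOf-comps (node ⊖ l r i) cs = refl

-- build t (Z₀ ∷ … ∷ Z_q) (β₁ ∷ … ∷ β_q) appends to the word of t the ⊕-letters of Z₀, the letter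
-- ⊖ β₁, the ⊕-letters of Z₁, and so on; every tree is uniquely of the form build leaf Zs bs.
build : ∀ {q} → Tree → Vec Forest (suc q) → Vec (Ind ⊖) q → Tree
build t (X ∷ [])     []       = addAll t X
build t (X ∷ Z ∷ Zs) (ind b i ∷ bs) = build (node ⊖ (addAll t X) b i) (Z ∷ Zs) bs

Spine : Set
Spine = ∃ λ q → Vec Forest (suc q) × Vec (Ind ⊖) q

-- The word is read from its last letter, which is at the root. The head of `Zs` is the gap being
-- filled; a ⊖-letter closes it and opens a new one in front.
spine : ∀ {q} → Tree → Vec Forest (suc q) → Vec (Ind ⊖) q → Spine
spine leaf           Zs       bs = _ , Zs , bs
spine (node ⊕ l r i) (Z ∷ Zs) bs = spine l ((ind r i ∷ Z) ∷ Zs) bs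
spine (node ⊖ l r i) Zs       bs = spine l ([] ∷ Zs) (ind r i ∷ bs)

ofSpine : Spine → Tree
ofSpine (_ , Zs , bs) = build leaf Zs bs

ofSpine-spine : ∀ {q} t (Zs : Vec Forest (suc q)) bs → ofSpine (spine t Zs bs) ≡ build t Zs bs
ofSpine-spine leaf           Zs       bs = refl
ofSpine-spine (node ⊕ l r i) (Z ∷ []) [] = ofSpine-spine l ((ind r i ∷ Z) ∷ []) []
ofSpine-spine (node ⊕ l r i) (Z ∷ Y ∷ Zs) (b ∷ bs) = ofSpine-spine l ((ind r i ∷ Z) ∷ Y ∷ Zs) (b ∷ bs)
ofSpine-spine (node ⊖ l r i) (Z ∷ Zs) bs = ofSpine-spine l ([] ∷ Z ∷ Zs) (ind r i ∷ bs)

spine-addAll : ∀ {q} t X Y (Zs : Vec Forest q) bs →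
  spine (addAll t X) (Y ∷ Zs) bs ≡ spine t ((X ++ Y) ∷ Zs) bs
spine-addAll t []       Y Zs bs = refl
spine-addAll t (ind r i ∷ cs) Y Zs bs = spine-addAll (node ⊕ t r i) cs Y Zs bs

-- With `ofSpine-spine` this makes trees and spines correspond one to one, so the map may be defined
-- on spines.
spine-build : ∀ {q} t (Zs : Vec Forest (suc q)) bs → spine (build t Zs bs) ([] ∷ []) [] ≡ spine t Zs bs
spine-build t (X ∷ []) [] rewrite spine-addAll t X [] [] [] | List.++-identityʳ X = refl
spine-build t (X ∷ Z ∷ Zs) (ind b i ∷ bs)
  rewrite spine-build (node ⊖ (addAll t X) b i) (Z ∷ Zs) bs
        | spine-addAll t X [] (Z ∷ Zs) (ind b i ∷ bs) | List.++-identityʳ X = refl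

-- Redistributing a list over gaps

module _ {A : Set} where

  flat : ∀ {n} → Vec (List A) n → List A
  flat []       = []
  flat (X ∷ Xs) = X ++ flat Xs

  cut : ∀ {n} → Vec ℕ n → List A → Vec (List A) n
  cut []       L = []
  cut (n ∷ ns) L = take n L ∷ cut ns (drop n L)

  lengths : ∀ {n} → Vec (List A) n → Vec ℕ n
  lengths = Vec.map length

  -- Reversing the pattern of ⊕ and ⊖ in a word reverses the numbers of ⊕-letters in the gaps, while
  -- the ⊕-letters themselves keep their order.
  recut : ∀ {n} → Vec (List A) n → Vec (List A) n
  recut Ls = cut (reverse (lengths Ls)) (flat Ls)

  sum-∷ʳ : ∀ {n} (ns : Vec ℕ n) m → sum (ns Vec.∷ʳ m) ≡ m + sum ns
  sum-∷ʳ []       m = refl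
  sum-∷ʳ (n ∷ ns) m rewrite sum-∷ʳ ns m =
    trans (sym (+-assoc n m _)) (trans (cong (_+ sum ns) (+-comm n m)) (+-assoc m n _))

  sum-reverse : ∀ {n} (ns : Vec ℕ n) → sum (reverse ns) ≡ sum ns
  sum-reverse []       = refl
  sum-reverse (n ∷ ns) rewrite Vec.reverse-∷ n ns | sum-∷ʳ (reverse ns) n = cong (n +_) (sum-reverse ns)

  length-flat : ∀ {n} (Ls : Vec (List A) n) → length (flat Ls) ≡ sum (lengths Ls)
  length-flat []       = refl
  length-flat (L ∷ Ls) = trans (List.length-++ L) (cong (length L +_) (length-flat Ls))

  cut-flat : ∀ {n} (Ls : Vec (List A) n) → cut (lengths Ls) (flat Ls) ≡ Ls
  cut-flat []       = refl
  cut-flat (L ∷ Ls) = cong₂ _∷_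
    (take-++ L (flat Ls))
    (trans (cong (cut (lengths Ls)) (drop-++ L (flat Ls))) (cut-flat Ls))
    where
    take-++ : ∀ xs ys → take (length xs) (xs ++ ys) ≡ xs
    take-++ []       ys = refl
    take-++ (x ∷ xs) ys = cong (x ∷_) (take-++ xs ys)
    drop-++ : ∀ xs ys → drop (length xs) (xs ++ ys) ≡ ys
    drop-++ []       ys = refl
    drop-++ (x ∷ xs) ys = drop-++ xs ys

  flat-cut : ∀ {n} (ns : Vec ℕ n) (L : List A) → sum ns ≡ length L → flat (cut ns L) ≡ L
  flat-cut []       []       _ = refl
  flat-cut (n ∷ ns) L        e = trans (cong (take n L ++_) (flat-cut ns (drop n L) e′)) (List.take++drop≡id n L)
    where
    e′ : sum ns ≡ length (drop n L)
    e′ = sym (trans (List.length-drop n L) (trans (cong (_∸ n) (sym e)) (m+n∸m≡n n _)))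

  lengths-cut : ∀ {n} (ns : Vec ℕ n) (L : List A) → sum ns ≡ length L → lengths (cut ns L) ≡ ns
  lengths-cut []       L e = refl
  lengths-cut (n ∷ ns) L e = cong₂ _∷_
    (trans (List.length-take n L) (m≤n⇒m⊓n≡m (subst (n ≤_) e (m≤m+n n _))))
    (lengths-cut ns (drop n L) (sym (trans (List.length-drop n L) (trans (cong (_∸ n) (sym e)) (m+n∸m≡n n _)))))

  module _ {n} (Ls : Vec (List A) n) where
    private
      e : sum (reverse (lengths Ls)) ≡ length (flat Ls)
      e = trans (sum-reverse (lengths Ls)) (sym (length-flat Ls))

    flat-recut : flat (recut Ls) ≡ flat Ls
    flat-recut = flat-cut (reverse (lengths Ls)) _ e

    lengths-recut : lengths (recut Ls) ≡ reverse (lengths Ls)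
    lengths-recut = lengths-cut (reverse (lengths Ls)) _ e

    -- `recut` fixes the concatenation and reverses the lengths, and these two determine the gaps.
    recut-involutive : recut (recut Ls) ≡ Ls
    recut-involutive rewrite flat-recut | lengths-recut | Vec.reverse-involutive (lengths Ls) = cut-flat Ls

  onHead : ∀ {n} → (List A → List A) → Vec (List A) (suc n) → Vec (List A) (suc n)
  onHead f (X ∷ Xs) = f X ∷ Xs

-- The involution on trees

-- The first argument is fuel: φ k is an involution for every k, but it exchanges the two statistics
-- only on trees of size at most k. This suffices, since Φ uses k = n on all permutations of [n].
φ : ℕ → Tree → Tree
φF : ℕ → Forest → Forest
rebuild : ℕ → Spine → Tree

φ zero    t = t
φ (suc k) t = rebuild k (spine t ([] ∷ []) [])

φF k []       = []
φF k (c ∷ cs) = comps (φ k (sumOf (c ∷ cs))) []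

rebuild k (zero  , X ∷ [] , []) = addAll leaf (φF k X)
-- Given enough fuel, the inner `φF k` makes the length of the first gap equal to its old `iarF`,
-- the reversal moves this length to the last gap, and the outer `φF k` turns the length of the new
-- first gap into its `iarF`.
rebuild k (suc q , Zs     , bs) = build leaf (onHead (φF k) (recut (onHead (φF k) Zs))) bs

spine-ofSpine : ∀ s → spine (ofSpine s) ([] ∷ []) [] ≡ s
spine-ofSpine (_ , Zs , bs) = spine-build leaf Zs bs

comps-nonempty : ∀ t cs → ∃₂ λ d ds → comps t cs ≡ d ∷ ds
comps-nonempty leaf           cs = _ , _ , refl
comps-nonempty (node ⊕ l r i) cs = comps-nonempty l _
comps-nonempty (node ⊖ l r i) cs = _ , _ , refl

comps-sumOf : ∀ c cs → comps (sumOf (c ∷ cs)) [] ≡ c ∷ cs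
comps-sumOf (ind t i) cs =
  trans (comps-addAll t cs []) (trans (comps-indec t i (cs ++ [])) (cong (ind t i ∷_) (List.++-identityʳ cs)))

φF-comps : ∀ k t → φF k (comps t []) ≡ comps (φ k t) []
φF-comps k t with comps t [] | comps-nonempty t [] | sumOf-comps t []
... | _ | _ , _ , refl | eq = cong (λ u → comps (φ k u) []) eq

φ-involutive : ∀ k t → φ k (φ k t) ≡ t
φF-involutive : ∀ k L → φF k (φF k L) ≡ L
-- With a ⊖-letter present, the gaps undergo the involution `recut` conjugated by the involution
-- `onHead (φF k)`. By `spine-ofSpine` the second application sees the very spine that the first one
-- produced.
rebuild-involutive : ∀ k s → rebuild k (spine (rebuild k s) ([] ∷ []) []) ≡ ofSpine s

φ-involutive zero    t = refl
φ-involutive (suc k) t = trans (rebuild-involutive k (spine t ([] ∷ []) [])) (ofSpine-spine t ([] ∷ []) [])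

φF-involutive k []       = refl
φF-involutive k (c ∷ cs) =
  trans (φF-comps k (φ k (sumOf (c ∷ cs)))) (trans (cong (λ t → comps t []) (φ-involutive k _)) (comps-sumOf c cs))

rebuild-involutive k (zero , X ∷ [] , [])
  rewrite spine-ofSpine (zero , φF k X ∷ [] , []) | φF-involutive k X = refl
rebuild-involutive k (suc q , X ∷ Zs , bs)
  rewrite spine-ofSpine (suc q , onHead (φF k) (recut (φF k X ∷ Zs)) , bs)
  with recut (φF k X ∷ Zs) | recut-involutive (φF k X ∷ Zs)
... | X′ ∷ Zs′ | eq rewrite φF-involutive k X′ | eq | φF-involutive k X = refl

-- Invariants of the map on trees

-- A state is passed down a tree: the left child inherits it, the right child of an o-node receives
-- its image under ρ o. The code lists the states of the leaves in the order of their values, not of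
-- their positions; suitable ρ turn it into the indicator words of LMAX, LMIN and DESB.
module Code {S : Set} (ρ : Op → S → S) where

  code : S → Tree → List S
  code s leaf           = s ∷ []
  code s (node ⊕ l r _) = code s l ++ code (ρ ⊕ s) r
  code s (node ⊖ l r _) = code (ρ ⊖ s) r ++ code s l

  codeF : S → Forest → List S
  codeF s []             = []
  codeF s (ind t _ ∷ cs) = code s t ++ codeF s cs

  codeF-++ : ∀ s cs ds → codeF s (cs ++ ds) ≡ codeF s cs ++ codeF s ds
  codeF-++ s []             ds = refl
  codeF-++ s (ind t _ ∷ cs) ds =
    trans (cong (code s t ++_) (codeF-++ s cs ds)) (sym (List.++-assoc (code s t) _ _))

  codeB : ∀ {q} → S → Vec (Ind ⊖) q → List S
  codeB s []             = []
  codeB s (ind b _ ∷ bs) = codeB s bs ++ code (ρ ⊖ s) b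

  code-addAll : ∀ s t cs → code s (addAll t cs) ≡ code s t ++ codeF (ρ ⊕ s) cs
  code-addAll s t []             = sym (List.++-identityʳ _)
  code-addAll s t (ind r i ∷ cs) =
    trans (code-addAll s (node ⊕ t r i) cs) (List.++-assoc (code s t) _ _)

  -- Left children inherit the state, so every ⊕-letter receives `ρ ⊕ s` and every ⊖-letter `ρ ⊖ s`,
  -- wherever it stands. In the order of values the ⊕-letters pile up above `t` and the ⊖-letters
  -- below it. Hence the code does not see how the two sequences interleave.
  code-build : ∀ {q} s t (Zs : Vec Forest (suc q)) bs →
    code s (build t Zs bs) ≡ codeB s bs ++ code s t ++ codeF (ρ ⊕ s) (flat Zs)
  code-build s t (X ∷ []) [] rewrite List.++-identityʳ X = code-addAll s t X
  code-build s t (X ∷ Z ∷ Zs) (ind b i ∷ bs) = begin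
    code s (build (node ⊖ (addAll t X) b i) (Z ∷ Zs) bs)
      ≡⟨ code-build s (node ⊖ (addAll t X) b i) (Z ∷ Zs) bs ⟩
    codeB s bs ++ (code (ρ ⊖ s) b ++ code s (addAll t X)) ++ F (Z ++ flat Zs)
      ≡⟨ cong (λ u → codeB s bs ++ (code (ρ ⊖ s) b ++ u) ++ F (Z ++ flat Zs)) (code-addAll s t X) ⟩
    codeB s bs ++ (code (ρ ⊖ s) b ++ code s t ++ F X) ++ F (Z ++ flat Zs)
      ≡⟨ cong (codeB s bs ++_) (List.++-assoc (code (ρ ⊖ s) b) _ _) ⟩
    codeB s bs ++ code (ρ ⊖ s) b ++ (code s t ++ F X) ++ F (Z ++ flat Zs)
      ≡⟨ List.++-assoc (codeB s bs) _ _ ⟨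
    codeB s (ind b i ∷ bs) ++ (code s t ++ F X) ++ F (Z ++ flat Zs)
      ≡⟨ cong (codeB s (ind b i ∷ bs) ++_) (List.++-assoc (code s t) _ _) ⟩
    codeB s (ind b i ∷ bs) ++ code s t ++ F X ++ F (Z ++ flat Zs)
      ≡⟨ cong (λ u → codeB s (ind b i ∷ bs) ++ code s t ++ u) (codeF-++ (ρ ⊕ s) X _) ⟨
    codeB s (ind b i ∷ bs) ++ code s t ++ F (X ++ Z ++ flat Zs) ∎
    where
    open ≡-Reasoning
    F = codeF (ρ ⊕ s)

  -- As a tree of its own, a forest gives its first component the state `s` and the others `ρ ⊕ s`;
  -- within a gap all have the same state. The hypothesis reconciles the two, and gaps satisfy it
  -- because `ρ ⊕` is idempotent.
  code-sumOf : ∀ s c cs → ρ ⊕ s ≡ s → code s (sumOf (c ∷ cs)) ≡ codeF s (c ∷ cs)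
  code-sumOf s (ind t _) cs e = trans (code-addAll s t cs) (cong (λ s′ → code s t ++ codeF s′ cs) e)

  codeF-comps : ∀ s t → ρ ⊕ s ≡ s → codeF s (comps t []) ≡ code s t
  codeF-comps s t e with comps t [] | comps-nonempty t [] | sumOf-comps t []
  ... | _ | d , ds , refl | eq = trans (sym (code-sumOf s d ds e)) (cong (code s) eq)

  module _ (ρ-idem : ∀ s → ρ ⊕ (ρ ⊕ s) ≡ ρ ⊕ s) where

    code-φ : ∀ k s t → code s (φ k t) ≡ code s t
    code-φF : ∀ k s L → ρ ⊕ s ≡ s → codeF s (φF k L) ≡ codeF s L
    code-rebuild : ∀ k s sp → code s (rebuild k sp) ≡ code s (ofSpine sp)

    code-φ zero    s t = refl
    code-φ (suc k) s t =
      trans (code-rebuild k s (spine t ([] ∷ []) [])) (cong (code s) (ofSpine-spine t ([] ∷ []) []))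

    code-φF k s []       e = refl
    code-φF k s (c ∷ cs) e =
      trans (codeF-comps s (φ k (sumOf (c ∷ cs))) e) (trans (code-φ k s (sumOf (c ∷ cs))) (code-sumOf s c cs e))

    code-rebuild k s (zero  , X ∷ [] , []) =
      trans (code-addAll s leaf (φF k X))
        (trans (cong (s ∷_) (code-φF k (ρ ⊕ s) X (ρ-idem s))) (sym (code-addAll s leaf X)))
    code-rebuild k s (suc q , Zs , bs) =
      trans (code-build s leaf (onHead (φF k) (recut (onHead (φF k) Zs))) bs)
        (trans (cong (λ u → codeB s bs ++ s ∷ u) codeF-recut) (sym (code-build s leaf Zs bs)))
      where
      F = codeF (ρ ⊕ s)
      codeF-onHead : ∀ Ys → F (flat (onHead (φF k) Ys)) ≡ F (flat {n = suc (suc q)} Ys)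
      codeF-onHead (Y ∷ Ys) =
        trans (codeF-++ _ (φF k Y) _)
          (trans (cong (_++ F (flat Ys)) (code-φF k (ρ ⊕ s) Y (ρ-idem s))) (sym (codeF-++ _ Y _)))
      codeF-recut : F (flat (onHead (φF k) (recut (onHead (φF k) Zs)))) ≡ F (flat Zs)
      codeF-recut =
        trans (codeF-onHead (recut (onHead (φF k) Zs)))
          (trans (cong F (flat-recut (onHead (φF k) Zs))) (codeF-onHead Zs))

size : Tree → ℕ
size leaf           = 1
size (node _ l r _) = size l + size r

module _ {S : Set} (ρ : Op → S → S) where
  open Code ρ

  length-code : ∀ s t → length (code s t) ≡ size t
  length-code s leaf           = refl
  length-code s (node ⊕ l r _) = trans (List.length-++ (code s l)) (cong₂ _+_ (length-code s l) (length-code _ r))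
  length-code s (node ⊖ l r _) =
    trans (List.length-++ (code (ρ ⊖ s) r))
      (trans (cong₂ _+_ (length-code _ r) (length-code s l)) (+-comm (size r) _))

-- With a single state only the length of the code is left, and that is the size.
size-φ : ∀ k t → size (φ k t) ≡ size t
size-φ k t =
  trans (sym (length-code ρ tt (φ k t))) (trans (cong length (code-φ (λ _ → refl) k tt t)) (length-code ρ tt t))
  where
  ρ : Op → ⊤ → ⊤
  ρ _ _ = tt
  open Code ρ

-- For the tree of a permutation this says that it avoids 312.
SkewLeaf : Tree → Set
SkewLeaf leaf           = ⊤
SkewLeaf (node ⊕ l r _) = SkewLeaf l × SkewLeaf r
SkewLeaf (node ⊖ l r _) = SkewLeaf l × r ≡ leaf

SkewLeafF : Forest → Set
SkewLeafF = All (λ c → SkewLeaf (Ind.tree c))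

SkewLeafS : Spine → Set
SkewLeafS (_ , Zs , bs) = SkewLeafF (flat Zs) × VAll.All (λ b → Ind.tree b ≡ leaf) bs

skewLeaf-addAll : ∀ t cs → SkewLeaf t → SkewLeafF cs → SkewLeaf (addAll t cs)
skewLeaf-addAll t []             p []       = p
skewLeaf-addAll t (ind r i ∷ cs) p (q ∷ qs) = skewLeaf-addAll (node ⊕ t r i) cs (p , q) qs

skewLeaf-comps : ∀ t cs → SkewLeaf t → SkewLeafF cs → SkewLeafF (comps t cs)
skewLeaf-comps leaf           cs p       qs = p ∷ qs
skewLeaf-comps (node ⊕ l r i) cs (p , q) qs = skewLeaf-comps l (ind r i ∷ cs) p (q ∷ qs)
skewLeaf-comps (node ⊖ l r i) cs p       qs = p ∷ qs

skewLeaf-spine : ∀ {q} t (Zs : Vec Forest (suc q)) bs →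
  SkewLeaf t → SkewLeafS (q , Zs , bs) → SkewLeafS (spine t Zs bs)
skewLeaf-spine leaf           Zs       bs _       qs = qs
skewLeaf-spine (node ⊕ l r i) (Z ∷ Zs) bs (p , q) (qs , rs) = skewLeaf-spine l _ bs p (q ∷ qs , rs)
skewLeaf-spine (node ⊖ l r i) Zs       bs (p , q) (qs , rs) = skewLeaf-spine l _ _ p (qs , q ∷ rs)

skewLeaf-build : ∀ {q} t (Zs : Vec Forest (suc q)) bs →
  SkewLeaf t → SkewLeafS (q , Zs , bs) → SkewLeaf (build t Zs bs)
skewLeaf-build t (X ∷ []) [] p (qs , _) = skewLeaf-addAll t X p (All.++⁻ˡ X qs)
skewLeaf-build t (X ∷ Z ∷ Zs) (ind b i ∷ bs) p (qs , r ∷ rs) =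
  skewLeaf-build (node ⊖ (addAll t X) b i) (Z ∷ Zs) bs
    (skewLeaf-addAll t X p (All.++⁻ˡ X qs) , r) (All.++⁻ʳ X qs , rs)

-- The ⊖-letters of a spine are never altered, and the ⊕-letters are only redistributed, except in
-- the first gap, where induction applies.
skewLeaf-φ : ∀ k t → SkewLeaf t → SkewLeaf (φ k t)
skewLeaf-φF : ∀ k L → SkewLeafF L → SkewLeafF (φF k L)
skewLeaf-rebuild : ∀ k s → SkewLeafS s → SkewLeaf (rebuild k s)

skewLeaf-φ zero    t p = p
skewLeaf-φ (suc k) t p = skewLeaf-rebuild k _ (skewLeaf-spine t ([] ∷ []) [] p ([] , []))

skewLeaf-φF k []             []       = []
skewLeaf-φF k (ind t _ ∷ cs) (p ∷ ps) = skewLeaf-comps _ [] (skewLeaf-φ k _ (skewLeaf-addAll t cs p ps)) []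

skewLeaf-rebuild k (zero  , X ∷ [] , []) (ps , _) = skewLeaf-addAll leaf _ _ (skewLeaf-φF k X (All.++⁻ˡ X ps))
skewLeaf-rebuild k (suc q , Zs , bs) (ps , qs) =
  skewLeaf-build leaf (onHead (φF k) (recut Ys)) bs _
    (onHead⁺ (recut Ys) (subst SkewLeafF (sym (flat-recut Ys)) (onHead⁺ Zs ps)) , qs)
  where
  Ys = onHead (φF k) Zs
  onHead⁺ : ∀ (Ys : Vec Forest (suc (suc q))) → SkewLeafF (flat Ys) → SkewLeafF (flat (onHead (φF k) Ys))
  onHead⁺ (Y ∷ Ys) ps = All.++⁺ (skewLeaf-φF k Y (All.++⁻ˡ Y ps)) (All.++⁻ʳ Y ps)

-- Exchange of the two statistics

-- The word, with values lo, lo + 1, …, of the permutation that a tree stands for.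
ev : ℕ → Tree → List ℕ
ev lo leaf           = lo ∷ []
ev lo (node ⊕ l r _) = ev lo l ++ ev (lo + size l) r
ev lo (node ⊖ l r _) = ev (lo + size r) l ++ ev lo r

evF : ℕ → Forest → List ℕ
evF lo []             = []
evF lo (ind t _ ∷ cs) = ev lo t ++ evF (lo + size t) cs

ev-addAll : ∀ lo t cs → ev lo (addAll t cs) ≡ ev lo t ++ evF (lo + size t) cs
ev-addAll lo t []             = sym (List.++-identityʳ _)
ev-addAll lo t (ind r i ∷ cs) rewrite ev-addAll lo (node ⊕ t r i) cs | +-assoc lo (size t) (size r) =
  List.++-assoc (ev lo t) _ _

ev-nonempty : ∀ lo t → ∃₂ λ x xs → ev lo t ≡ x ∷ xs
ev-nonempty lo leaf = _ , _ , refl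
ev-nonempty lo (node ⊕ l r i) with ev lo l | ev-nonempty lo l
... | _ | _ , _ , refl = _ , _ , refl
ev-nonempty lo (node ⊖ l r i) with ev (lo + size r) l | ev-nonempty (lo + size r) l
... | _ | _ , _ , refl = _ , _ , refl

ev-≥ : ∀ lo t → All (lo ≤_) (ev lo t)
ev-≥ lo leaf = ≤-refl ∷ []
ev-≥ lo (node ⊕ l r _) = All.++⁺ (ev-≥ lo l) (All.map (≤-trans (m≤m+n lo _)) (ev-≥ (lo + size l) r))
ev-≥ lo (node ⊖ l r _) = All.++⁺ (All.map (≤-trans (m≤m+n lo _)) (ev-≥ (lo + size r) l)) (ev-≥ lo r)

ev-< : ∀ lo t → All (_< lo + size t) (ev lo t)
ev-< lo leaf = m<m+n lo (s≤s z≤n) ∷ []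
ev-< lo (node ⊕ l r _) = All.++⁺
  (All.map (λ p → <-≤-trans p (+-monoʳ-≤ lo (m≤m+n (size l) _))) (ev-< lo l))
  (subst (λ m → All (_< m) (ev (lo + size l) r)) (+-assoc lo (size l) (size r)) (ev-< (lo + size l) r))
ev-< lo (node ⊖ l r _) = All.++⁺
  (subst (λ m → All (_< m) (ev (lo + size r) l))
    (trans (+-assoc lo (size r) (size l)) (cong (lo +_) (+-comm (size r) _)))
    (ev-< (lo + size r) l))
  (All.map (λ p → <-≤-trans p (+-monoʳ-≤ lo (m≤n+m (size r) _))) (ev-< lo r))

evF-≥ : ∀ lo cs → All (lo ≤_) (evF lo cs)
evF-≥ lo []             = []
evF-≥ lo (ind t _ ∷ cs) = All.++⁺ (ev-≥ lo t) (All.map (≤-trans (m≤m+n lo _)) (evF-≥ (lo + size t) cs))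

length-ev : ∀ lo t → length (ev lo t) ≡ size t
length-ev lo leaf = refl
length-ev lo (node ⊕ l r _) = trans (List.length-++ (ev lo l)) (cong₂ _+_ (length-ev lo l) (length-ev _ r))
length-ev lo (node ⊖ l r _) = trans (List.length-++ (ev _ l)) (cong₂ _+_ (length-ev _ l) (length-ev lo r))

size-pos : ∀ t → 1 ≤ size t
size-pos leaf           = s≤s z≤n
size-pos (node _ l r _) = ≤-trans (size-pos l) (m≤m+n _ _)

ev-suc : ∀ lo t → ev (suc lo) t ≡ List.map suc (ev lo t)
ev-suc lo leaf = refl
ev-suc lo (node ⊕ l r _) = trans (cong₂ _++_ (ev-suc lo l) (ev-suc _ r)) (sym (List.map-++ suc (ev lo l) _))
ev-suc lo (node ⊖ l r _) = trans (cong₂ _++_ (ev-suc _ l) (ev-suc lo r)) (sym (List.map-++ suc (ev _ l) _))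

iarList-suc : ∀ xs → iarList (List.map suc xs) ≡ iarList xs
iarList-suc []       = refl
iarList-suc (x ∷ xs) = nonempty x xs
  where
  nonempty : ∀ x xs → iarList (List.map suc (x ∷ xs)) ≡ iarList (x ∷ xs)
  nonempty x []       = refl
  nonempty x (y ∷ xs) with x <ᵇ y
  ... | true  = cong suc (nonempty y xs)
  ... | false = refl

iarT : Tree → ℕ
iarT t = iarList (ev 0 t)

iarF : Forest → ℕ
iarF []       = 0
iarF (c ∷ cs) = iarT (sumOf (c ∷ cs))

iarList-ev : ∀ lo t → iarList (ev lo t) ≡ iarT t
iarList-ev zero     t = refl
iarList-ev (suc lo) t = trans (cong iarList (ev-suc lo t)) (trans (iarList-suc (ev lo t)) (iarList-ev lo t))

iarList-evF : ∀ lo cs → iarList (evF lo cs) ≡ iarF cs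
iarList-evF lo []             = refl
iarList-evF lo (ind t i ∷ cs) = trans (cong iarList (sym (ev-addAll lo t cs))) (iarList-ev lo (addAll t cs))

iarList-∷ : ∀ x xs → All (x <_) xs → iarList (x ∷ xs) ≡ suc (iarList xs)
iarList-∷ x []       _       = refl
iarList-∷ x (y ∷ xs) (p ∷ _) rewrite dec-true (x <? y) p = refl

data HeadBelow : List ℕ → List ℕ → Set where
  empty  : ∀ {xs} → HeadBelow xs []
  below  : ∀ {xs y ys} → All (y <_) xs → HeadBelow xs (y ∷ ys)

HeadBelow-tail : ∀ {x xs ys} → HeadBelow (x ∷ xs) ys → HeadBelow xs ys
HeadBelow-tail empty           = empty
HeadBelow-tail (below (_ ∷ p)) = below p

-- The hypothesis concerns all of `x ∷ xs` so that it passes to tails; at the last entry it yields a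
-- descent into `ys`.
iarList-++ : ∀ x xs ys → HeadBelow (x ∷ xs) ys → iarList (x ∷ xs ++ ys) ≡ iarList (x ∷ xs)
iarList-++ x []        []       _               = refl
iarList-++ x []        (y ∷ ys) (below (p ∷ _)) rewrite dec-false (x <? y) (<-asym p) = refl
iarList-++ x (x′ ∷ xs) ys       h with x <ᵇ x′
... | true  = cong suc (iarList-++ x′ xs ys (HeadBelow-tail h))
... | false = refl

-- The first gap is followed by nothing or by a ⊖-letter, whose values lie below those of
-- `addAll t X`. So the initial run cannot leave the word of `addAll t X`.
ev-build : ∀ {q} lo t X (Zs : Vec Forest q) bs → ∃₂ λ lo′ ys →
  ev lo (build t (X ∷ Zs) bs) ≡ ev lo′ (addAll t X) ++ ys × HeadBelow (ev lo′ (addAll t X)) ys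
ev-build lo t X []       []             = lo , [] , sym (List.++-identityʳ _) , empty
ev-build lo t X (Z ∷ Zs) (ind b i ∷ bs) with ev-build lo (node ⊖ (addAll t X) b i) Z Zs bs
... | lo′ , ys , eq , _ with ev lo′ b in e | ev-nonempty lo′ b | ev-< lo′ b
... | _ | y , ys′ , refl | y< ∷ _ =
  -- The letter `b` takes the values from `lo′` on, which lifts `addAll t X` by `size b`.
  lo′ + size b , y ∷ ys′ ++ evF _ Z ++ ys ,
  trans eq (trans (cong (_++ ys) (ev-addAll lo′ (node ⊖ (addAll t X) b i) Z))
    (trans (List.++-assoc (ev lo′ (node ⊖ (addAll t X) b i)) _ ys)
      (trans (List.++-assoc (ev _ (addAll t X)) (ev lo′ b) _)
        (cong (λ u → ev (lo′ + size b) (addAll t X) ++ u ++ evF (lo′ + size (node ⊖ (addAll t X) b i)) Z ++ ys) e)))) ,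
  below (All.map (<-≤-trans y<) (ev-≥ (lo′ + size b) (addAll t X)))

-- The first entry is the least one of `addAll leaf X`, so it lengthens the initial run of `X` by
-- one.
iarT-build : ∀ {q} X (Zs : Vec Forest q) bs → iarT (build leaf (X ∷ Zs) bs) ≡ suc (iarF X)
iarT-build X Zs bs with ev-build 0 leaf X Zs bs
... | lo , ys , eq , h rewrite eq | ev-addAll lo leaf X =
  trans (iarList-++ lo _ ys h)
    (trans (iarList-∷ lo _ (subst (λ m → All (lo <_) (evF m X)) (+-comm 1 lo) (evF-≥ (suc lo) X)))
      (cong suc (iarList-evF (lo + 1) X)))

ncomp : Tree → ℕ
ncomp t = length (comps t [])

-- Up to the last ⊖-letter the tree is sum-indecomposable, and each later ⊕-letter adds one
-- component.
length-comps-build : ∀ {q} t (Zs : Vec Forest (suc q)) bs → Indec ⊕ t →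
  ncomp (build t Zs bs) ≡ suc (length (last Zs))
length-comps-build t (X ∷ []) [] i
  rewrite comps-addAll t X [] | List.++-identityʳ X | comps-indec t i X = refl
length-comps-build t (X ∷ Z ∷ Zs) (ind b i ∷ bs) _ = length-comps-build (node ⊖ (addAll t X) b i) (Z ∷ Zs) bs _

sizeF : Forest → ℕ
sizeF []             = 0
sizeF (ind t _ ∷ cs) = size t + sizeF cs

sizeF-++ : ∀ cs ds → sizeF (cs ++ ds) ≡ sizeF cs + sizeF ds
sizeF-++ []             ds = refl
sizeF-++ (ind t _ ∷ cs) ds = trans (cong (size t +_) (sizeF-++ cs ds)) (sym (+-assoc (size t) _ _))

size-addAll : ∀ t cs → size (addAll t cs) ≡ size t + sizeF cs
size-addAll t []             = sym (+-identityʳ _)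
size-addAll t (ind r i ∷ cs) = trans (size-addAll (node ⊕ t r i) cs) (+-assoc (size t) _ _)

size-sumOf : ∀ c cs → size (sumOf (c ∷ cs)) ≡ sizeF (c ∷ cs)
size-sumOf (ind t _) cs = size-addAll t cs

sizeF-comps : ∀ t cs → sizeF (comps t cs) ≡ size t + sizeF cs
sizeF-comps leaf           cs = refl
sizeF-comps (node ⊕ l r i) cs = trans (sizeF-comps l _) (sym (+-assoc (size l) _ _))
sizeF-comps (node ⊖ l r i) cs = refl

sizeF-φF : ∀ k L → sizeF (φF k L) ≡ sizeF L
sizeF-φF k []       = refl
sizeF-φF k (c ∷ cs) =
  trans (sizeF-comps (φ k (sumOf (c ∷ cs))) [])
    (trans (+-identityʳ _) (trans (size-φ k (sumOf (c ∷ cs))) (size-sumOf c cs)))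

-- This bounds the gaps, so that the fuel suffices for the calls of `φF k` on them.
size-build : ∀ {q} t (Zs : Vec Forest (suc q)) bs → size t + sizeF (flat Zs) ≤ size (build t Zs bs)
size-build t (X ∷ []) [] rewrite List.++-identityʳ X = ≤-reflexive (sym (size-addAll t X))
size-build t (X ∷ Z ∷ Zs) (ind b i ∷ bs) = ≤-trans lemma (size-build (node ⊖ (addAll t X) b i) (Z ∷ Zs) bs)
  where
  open ≤-Reasoning
  lemma : size t + sizeF (X ++ flat (Z ∷ Zs)) ≤ size (addAll t X) + size b + sizeF (flat (Z ∷ Zs))
  lemma = begin
    size t + sizeF (X ++ flat (Z ∷ Zs))            ≡⟨ cong (size t +_) (sizeF-++ X _) ⟩
    size t + (sizeF X + sizeF (flat (Z ∷ Zs)))     ≡⟨ +-assoc (size t) _ _ ⟨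
    size t + sizeF X + sizeF (flat (Z ∷ Zs))       ≡⟨ cong (_+ sizeF (flat (Z ∷ Zs))) (size-addAll t X) ⟨
    size (addAll t X) + sizeF (flat (Z ∷ Zs))      ≤⟨ +-monoˡ-≤ _ (m≤m+n (size (addAll t X)) (size b)) ⟩
    size (addAll t X) + size b + sizeF (flat (Z ∷ Zs)) ∎

last-map : ∀ {A B : Set} {n} (f : A → B) (xs : Vec A (suc n)) → last (Vec.map f xs) ≡ f (last xs)
last-map f (x ∷ [])     = refl
last-map f (x ∷ y ∷ xs) = last-map f (y ∷ xs)

Swaps : ℕ → ℕ → Tree → Set
Swaps i j t = ncomp t ≡ i × iarT t ≡ j

φ-swaps : ∀ k t → size t ≤ k → Swaps (iarT t) (ncomp t) (φ k t)
φF-swaps : ∀ k L → sizeF L ≤ k → length (φF k L) ≡ iarF L × iarF (φF k L) ≡ length L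
rebuild-swaps : ∀ k s → size (ofSpine s) ≤ suc k → Swaps (iarT (ofSpine s)) (ncomp (ofSpine s)) (rebuild k s)

φ-swaps zero    t p with () ← ≤-trans (size-pos t) p
φ-swaps (suc k) t p with rebuild-swaps k (spine t ([] ∷ []) []) | ofSpine-spine t ([] ∷ []) []
... | ih | eq rewrite eq = ih p

φF-swaps k []       _ = refl , refl
φF-swaps k (c ∷ cs) p with φ-swaps k (sumOf (c ∷ cs)) (subst (_≤ k) (sym (size-sumOf c cs)) p)
... | e₁ , e₂ = e₁ , trans (iarF-comps (φ k (sumOf (c ∷ cs)))) (trans e₂ (cong length (comps-sumOf c cs)))
  where
  iarF-comps : ∀ t → iarF (comps t []) ≡ iarT t
  iarF-comps t with comps t [] | comps-nonempty t [] | sumOf-comps t []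
  ... | _ | _ , _ , refl | eq = cong iarT eq

rebuild-swaps k (zero , X ∷ [] , []) p
  with e₁ , e₂ ← φF-swaps k X (≤-pred (subst (_≤ suc k) (size-addAll leaf X) p)) =
  trans (length-comps-build leaf (φF k X ∷ []) [] _) (trans (cong suc e₁) (sym (iarT-build X [] []))) ,
  trans (iarT-build (φF k X) [] []) (trans (cong suc e₂) (sym (length-comps-build leaf (X ∷ []) [] _)))
rebuild-swaps k (suc q , X ∷ Zs , bs) p
  with recut (φF k X ∷ Zs) | flat-recut (φF k X ∷ Zs) | lengths-recut (φF k X ∷ Zs)
... | X′ ∷ Zs′ | eqF | eqL =
  trans (length-comps-build leaf (φF k X′ ∷ Zs′) bs _) (trans (cong suc length-last) (sym (iarT-build X Zs bs))) ,
  trans (iarT-build (φF k X′) Zs′ bs)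
    (trans (cong suc (trans (proj₂ (φF-swaps k X′ X′≤k)) length-head))
      (sym (length-comps-build leaf (X ∷ Zs) bs _)))
  where
  open ≤-Reasoning
  -- The initial leaf takes one unit of `suc k`.
  total≤k : sizeF (flat (X ∷ Zs)) ≤ k
  total≤k = ≤-pred (≤-trans (size-build leaf (X ∷ Zs) bs) p)

  X≤k : sizeF X ≤ k
  X≤k = ≤-trans (subst (sizeF X ≤_) (sym (sizeF-++ X (flat Zs))) (m≤m+n _ _)) total≤k

  -- The new first gap is a prefix of the recut list, whose total size is that of the old gaps
  -- because `φF k` preserves size.
  X′≤k : sizeF X′ ≤ k
  X′≤k = begin
    sizeF X′                       ≤⟨ m≤m+n _ _ ⟩
    sizeF X′ + sizeF (flat Zs′)    ≡⟨ sizeF-++ X′ (flat Zs′) ⟨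
    sizeF (X′ ++ flat Zs′)         ≡⟨ cong sizeF eqF ⟩
    sizeF (φF k X ++ flat Zs)      ≡⟨ sizeF-++ (φF k X) (flat Zs) ⟩
    sizeF (φF k X) + sizeF (flat Zs) ≡⟨ cong (_+ sizeF (flat Zs)) (sizeF-φF k X) ⟩
    sizeF X + sizeF (flat Zs)      ≡⟨ sizeF-++ X (flat Zs) ⟨
    sizeF (flat (X ∷ Zs))          ≤⟨ total≤k ⟩
    k                              ∎

  length-last : length (last Zs′) ≡ iarF X
  length-last = begin-equality
    length (last Zs′)                       ≡⟨ last-map length (X′ ∷ Zs′) ⟨
    last (lengths (X′ ∷ Zs′))               ≡⟨ cong last eqL ⟩
    last (reverse (lengths (φF k X ∷ Zs)))  ≡⟨ Vec.last-reverse (lengths (φF k X ∷ Zs)) ⟩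
    length (φF k X)                         ≡⟨ proj₁ (φF-swaps k X X≤k) ⟩
    iarF X                                  ∎

  length-head : length X′ ≡ length (last Zs)
  length-head = begin-equality
    length X′                               ≡⟨ cong head eqL ⟩
    head (reverse (lengths (φF k X ∷ Zs)))  ≡⟨ Vec.last-reverse (reverse (lengths (φF k X ∷ Zs))) ⟨
    last (reverse (reverse (lengths (φF k X ∷ Zs)))) ≡⟨ cong last (Vec.reverse-involutive (lengths (φF k X ∷ Zs))) ⟩
    last (lengths Zs)                       ≡⟨ last-map length Zs ⟩
    length (last Zs)                        ∎

-- Trees of words

opp : Op → Op
opp ⊕ = ⊖
opp ⊖ = ⊕

-- An order for each operation, so that one argument treats both: in an `o`-sum every left entry is
-- `<[ o ]` every right entry.
_<[_]_ : ℕ → Op → ℕ → Set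
a <[ ⊕ ] b = a < b
a <[ ⊖ ] b = b < a

<[]-trans : ∀ o {a b c} → a <[ o ] b → b <[ o ] c → a <[ o ] c
<[]-trans ⊕ p q = <-trans p q
<[]-trans ⊖ p q = <-trans q p

<[]-asym : ∀ o {a b} → a <[ o ] b → ¬ b <[ o ] a
<[]-asym ⊕ = <-asym
<[]-asym ⊖ = <-asym

<[]-irrefl : ∀ o {a} → ¬ a <[ o ] a
<[]-irrefl ⊕ = <-irrefl refl
<[]-irrefl ⊖ = <-irrefl refl

<[]-opp : ∀ o {a b} → a <[ o ] b → b <[ opp o ] a
<[]-opp ⊕ p = p
<[]-opp ⊖ p = p

<[]-opp⁻ : ∀ o {a b} → a <[ opp o ] b → b <[ o ] a
<[]-opp⁻ ⊕ p = p
<[]-opp⁻ ⊖ p = p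

<[]-compare : ∀ o a b → a <[ o ] b ⊎ a ≡ b ⊎ b <[ o ] a
<[]-compare o a b with <-cmp a b
<[]-compare ⊕ a b | tri< p _ _ = inj₁ p
<[]-compare ⊕ a b | tri≈ _ p _ = inj₂ (inj₁ p)
<[]-compare ⊕ a b | tri> _ _ p = inj₂ (inj₂ p)
<[]-compare ⊖ a b | tri< p _ _ = inj₂ (inj₂ p)
<[]-compare ⊖ a b | tri≈ _ p _ = inj₂ (inj₁ p)
<[]-compare ⊖ a b | tri> _ _ p = inj₁ p

<[]-unique : ∀ o o′ {a b} → a <[ o ] b → a <[ o′ ] b → o ≡ o′
<[]-unique ⊕ ⊕ p q = refl
<[]-unique ⊕ ⊖ p q = ⊥-elim (<-asym p q)
<[]-unique ⊖ ⊕ p q = ⊥-elim (<-asym p q)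
<[]-unique ⊖ ⊖ p q = refl

op-cases : ∀ o o′ → o′ ≡ o ⊎ o′ ≡ opp o
op-cases ⊕ ⊕ = inj₁ refl
op-cases ⊕ ⊖ = inj₂ refl
op-cases ⊖ ⊕ = inj₂ refl
op-cases ⊖ ⊖ = inj₁ refl

opp-indec : ∀ o {l r} .{i} → Indec (opp o) (node o l r i)
opp-indec ⊕ = tt
opp-indec ⊖ = tt

indec-opp : ∀ o o′ {l r} .{i} → .(Indec o (node o′ l r i)) → o′ ≡ opp o
indec-opp ⊕ ⊖ _ = refl
indec-opp ⊖ ⊕ _ = refl

_≪[_]_ : List ℕ → Op → List ℕ → Set
xs ≪[ o ] ys = All (λ x → All (x <[ o ]_) ys) xs

≪-lookup : ∀ o {xs ys x y} → xs ≪[ o ] ys → x ∈ xs → y ∈ ys → x <[ o ] y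
≪-lookup _ p x∈ y∈ = All.lookup (All.lookup p x∈) y∈

-- The values need not be consecutive, because the parser works through the suffixes of a word.
data Shape : Tree → List ℕ → Set where
  leaf : ∀ x → Shape leaf [ x ]
  node : ∀ {o l r xs ys} .{i} → Shape l xs → Shape r ys → xs ≪[ o ] ys → Shape (node o l r i) (xs ++ ys)

shape-nonempty : ∀ {t zs} → Shape t zs → ∃ λ z → z ∈ zs
shape-nonempty (leaf x)     = x , here refl
shape-nonempty (node p _ _) with shape-nonempty p
... | z , z∈ = z , ∈-++⁺ˡ z∈

shape-length : ∀ {t zs} → Shape t zs → length zs ≡ size t
shape-length (leaf x) = refl
shape-length (node {xs = xs} p q _) = trans (List.length-++ xs) (cong₂ _+_ (shape-length p) (shape-length q))

⊕-≪ : ∀ lo l r → ev lo l ≪[ ⊕ ] ev (lo + size l) r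
⊕-≪ lo l r = All.map (λ x< → All.map (<-≤-trans x<) (ev-≥ _ r)) (ev-< lo l)

⊖-≪ : ∀ lo l r → ev (lo + size r) l ≪[ ⊖ ] ev lo r
⊖-≪ lo l r = All.map (λ ≤x → All.map (λ y< → <-≤-trans y< ≤x) (ev-< lo r)) (ev-≥ _ l)

shape-ev : ∀ lo t → Shape t (ev lo t)
shape-ev lo leaf           = leaf lo
shape-ev lo (node ⊕ l r _) = node (shape-ev lo l) (shape-ev _ r) (⊕-≪ lo l r)
shape-ev lo (node ⊖ l r _) = node (shape-ev _ l) (shape-ev lo r) (⊖-≪ lo l r)

-- 3142 for o = ⊕ and 2413 for o = ⊖.
data Crossing (o : Op) : List ℕ → Set where
  crossing : ∀ {x c a b} → c <[ o ] b → b <[ o ] x → x <[ o ] a → Crossing o (x ∷ c ∷ a ∷ b ∷ [])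

data Bad (xs : List ℕ) : Set where
  repeat : ∀ {x} → x ∷ x ∷ [] ⊆ xs → Bad xs
  cross  : ∀ {o ws} → Crossing o ws → ws ⊆ xs → Bad xs

bad-⊆ : ∀ {xs ys} → xs ⊆ ys → Bad xs → Bad ys
bad-⊆ p (repeat q)  = repeat (⊆-trans q p)
bad-⊆ p (cross c q) = cross c (⊆-trans q p)

⊆-++⁻ : ∀ as {bs ws : List ℕ} → ws ⊆ as ++ bs → ∃₂ λ us vs → ws ≡ us ++ vs × us ⊆ as × vs ⊆ bs
⊆-++⁻ []       p        = [] , _ , refl , [] , p
⊆-++⁻ (a ∷ as) (_ ∷ʳ p) with ⊆-++⁻ as p
... | us , vs , e , q , r = us , vs , e , _ ∷ʳ q , r
⊆-++⁻ (a ∷ as) (refl ∷ p) with ⊆-++⁻ as p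
... | us , vs , e , q , r = a ∷ us , vs , cong (a ∷_) e , refl ∷ q , r

≪-⊆ : ∀ {o as bs us vs} → as ≪[ o ] bs → us ⊆ as → vs ⊆ bs → us ≪[ o ] vs
≪-⊆ p q r = All.map (All-resp-⊆ r) (All-resp-⊆ q p)

-- 3142 and 2413 are simple: across each of the three cuts there is a pair in the order `o` and a
-- pair in the opposite order.
crossing-unsplit : ∀ o o′ us vs {u v} → Crossing o ((u ∷ us) ++ (v ∷ vs)) → ¬ ((u ∷ us) ≪[ o′ ] (v ∷ vs))
crossing-unsplit o o′ us vs c p with op-cases o o′
crossing-unsplit o o′ [] _ (crossing cb bx xa) ((p₁ ∷ p₂ ∷ _) ∷ _) | inj₁ refl =
  <[]-asym o p₁ (<[]-trans o cb bx)
crossing-unsplit o o′ (_ ∷ []) _ (crossing cb bx xa) ((_ ∷ p ∷ _) ∷ _) | inj₁ refl = <[]-asym o p bx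
crossing-unsplit o o′ (_ ∷ _ ∷ []) _ (crossing cb bx xa) ((p ∷ _) ∷ _) | inj₁ refl = <[]-asym o p bx
crossing-unsplit o o′ (_ ∷ _ ∷ _ ∷ []) _ () _ | inj₁ refl
crossing-unsplit o o′ (_ ∷ _ ∷ _ ∷ _ ∷ _) _ () _ | inj₁ refl
crossing-unsplit o o′ [] _ (crossing cb bx xa) ((_ ∷ p ∷ _) ∷ _) | inj₂ refl = <[]-asym o xa (<[]-opp⁻ o p)
crossing-unsplit o o′ (_ ∷ []) _ (crossing cb bx xa) (_ ∷ (_ ∷ p ∷ _) ∷ _) | inj₂ refl = <[]-asym o cb (<[]-opp⁻ o p)
crossing-unsplit o o′ (_ ∷ _ ∷ []) _ (crossing cb bx xa) (_ ∷ (p ∷ _) ∷ _) | inj₂ refl = <[]-asym o cb (<[]-opp⁻ o p)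
crossing-unsplit o o′ (_ ∷ _ ∷ _ ∷ []) _ () _ | inj₂ refl
crossing-unsplit o o′ (_ ∷ _ ∷ _ ∷ _ ∷ _) _ () _ | inj₂ refl

shape-¬crossing : ∀ {t zs o ws} → Shape t zs → Crossing o ws → ¬ (ws ⊆ zs)
shape-¬crossing (leaf x) (crossing _ _ _) (_ ∷ʳ ())
shape-¬crossing (leaf x) (crossing _ _ _) (refl ∷ ())
shape-¬crossing {o = o} (node {o = o′} {xs = xs} p q s) c sub with ⊆-++⁻ xs sub
... | []     , vs     , refl , _  , sv = shape-¬crossing q c sv
... | us     , []     , refl , su , _  = shape-¬crossing p (subst (Crossing o) (List.++-identityʳ us) c) su
... | u ∷ us , v ∷ vs , refl , su , sv = crossing-unsplit o o′ us vs c (≪-⊆ s su sv)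

shape-¬repeat : ∀ {t zs x} → Shape t zs → ¬ (x ∷ x ∷ [] ⊆ zs)
shape-¬repeat (leaf x) (_ ∷ʳ ())
shape-¬repeat (leaf x) (refl ∷ ())
shape-¬repeat (node {o = o} {xs = xs} p q s) sub with ⊆-++⁻ xs sub
... | []         , _     , refl , _  , sv = shape-¬repeat q sv
... | _ ∷ _ ∷ [] , []    , refl , su , _  = shape-¬repeat p su
... | x ∷ []     , _ ∷ _ , refl , su , sv with ≪-⊆ {o} s su sv
... | (x<x ∷ _) ∷ _ = <[]-irrefl o x<x

shape-¬bad : ∀ {t zs} → Shape t zs → ¬ Bad zs
shape-¬bad p (repeat q)  = shape-¬repeat p q
shape-¬bad p (cross c q) = shape-¬crossing p c q

-- Existence of the tree of a word

module _ (o : Op) (x : ℕ) where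

  all-above? : ∀ ys → All (x <[ o ]_) ys ⊎ x ∈ ys ⊎ ∃ λ y → y ∈ ys × y <[ o ] x
  all-above? []       = inj₁ []
  all-above? (y ∷ ys) with <[]-compare o x y | all-above? ys
  ... | inj₁ p           | inj₁ ps                   = inj₁ (p ∷ ps)
  ... | inj₁ p           | inj₂ (inj₁ x∈)            = inj₂ (inj₁ (there x∈))
  ... | inj₁ p           | inj₂ (inj₂ (z , z∈ , z<)) = inj₂ (inj₂ (z , there z∈ , z<))
  ... | inj₂ (inj₁ refl) | _                         = inj₂ (inj₁ (here refl))
  ... | inj₂ (inj₂ p)    | _                         = inj₂ (inj₂ (y , here refl , p))

all-below? : ∀ o x ys → All (_<[ o ] x) ys ⊎ x ∈ ys ⊎ ∃ λ y → y ∈ ys × x <[ o ] y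
all-below? o x ys with all-above? (opp o) x ys
... | inj₁ ps                   = inj₁ (All.map (<[]-opp⁻ o) ps)
... | inj₂ (inj₁ x∈)            = inj₂ (inj₁ x∈)
... | inj₂ (inj₂ (y , y∈ , p)) = inj₂ (inj₂ (y , y∈ , <[]-opp⁻ o p))

data Side (o : Op) (x : ℕ) (ys : List ℕ) : Set where
  above    : All (x <[ o ]_) ys → Side o x ys
  below    : All (_<[ o ] x) ys → Side o x ys
  occurs   : x ∈ ys → Side o x ys
  straddle : ∀ {a b} → b <[ o ] x → x <[ o ] a → a ∷ b ∷ [] ⊆ ys → Side o x ys

-- An `o`-indecomposable tree is a leaf or an opposite node, whose left part lies above its right
-- part in the order `o`. If `x` is neither below the right part nor above the left one, it occurs
-- in one of them, or it exceeds some `b` on the right and is exceeded by some `a` on the left.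
side : ∀ o x {r ys} → .(Indec o r) → Shape r ys → Side o x ys
side o x _ (leaf y) with <[]-compare o x y
... | inj₁ p           = above (p ∷ [])
... | inj₂ (inj₁ refl) = occurs (here refl)
... | inj₂ (inj₂ p)    = below (p ∷ [])
side o x i (node {o = o′} {xs = as} {ys = bs} p q s) with refl ← indec-opp o o′ i
  with all-above? o x bs | all-below? o x as
... | inj₁ x<bs | _ = above (All.++⁺ (All.map x<as s) x<bs)
  where
  x<as : ∀ {a} → All (a <[ opp o ]_) bs → x <[ o ] a
  x<as a>bs with shape-nonempty q
  ... | b , b∈ = <[]-trans o (All.lookup x<bs b∈) (<[]-opp⁻ o (All.lookup a>bs b∈))
... | inj₂ (inj₁ x∈bs) | _ = occurs (∈-++⁺ʳ as x∈bs)
... | inj₂ (inj₂ _) | inj₁ as<x = below (All.++⁺ as<x (All.tabulate bs<x))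
  where
  bs<x : ∀ {b} → b ∈ bs → b <[ o ] x
  bs<x b∈ with shape-nonempty p
  ... | a , a∈ = <[]-trans o (<[]-opp⁻ o (≪-lookup (opp o) s a∈ b∈)) (All.lookup as<x a∈)
... | inj₂ (inj₂ _) | inj₂ (inj₁ x∈as) = occurs (∈-++⁺ˡ x∈as)
... | inj₂ (inj₂ (b , b∈ , b<x)) | inj₂ (inj₂ (a , a∈ , x<a)) = straddle b<x x<a (++⁺ (from∈ a∈) (from∈ b∈))

Parse : List ℕ → Set
Parse zs = (∃ λ t → Shape t zs) ⊎ Bad zs

-- Compare `x` with the last `o`-summand `r` in the order `o`. If `x` is below, `r` stays the last
-- summand and `x` moves into the left child; if `x` is above `r`, it is above everything and the
-- new root is opposite. If `x` straddles `r`, any entry `c` of the left child completes the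
-- crossing `x c a b`.
prepend : ∀ x {t ys} → Shape t ys → Parse (x ∷ ys)
prepend x (leaf y) with <[]-compare ⊕ x y
... | inj₁ p           = inj₁ (_ , node {⊕} {i = tt} (leaf x) (leaf y) ((p ∷ []) ∷ []))
... | inj₂ (inj₁ refl) = inj₂ (repeat ⊆-refl)
... | inj₂ (inj₂ p)    = inj₁ (_ , node {⊖} {i = tt} (leaf x) (leaf y) ((p ∷ []) ∷ []))
prepend x (node {o} {l} {r} {xs} {ys} {i} p q s) with side o x i q
... | above x<ys with prepend x p
...   | inj₁ (_ , p′) = inj₁ (_ , node {i = i} p′ q (x<ys ∷ s))
...   | inj₂ bad      = inj₂ (bad-⊆ (++⁺ʳ ys ⊆-refl) bad)
prepend x (node {o} {l} {r} {xs} {ys} {i} p q s) | below ys<x =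
  inj₁ (_ , node {opp o} {i = opp-indec o} (leaf x) (node {i = i} p q s)
    (All.map (<[]-opp o) (All.++⁺ (All.map xs<x s) ys<x) ∷ []))
  where
  xs<x : ∀ {z} → All (z <[ o ]_) ys → z <[ o ] x
  xs<x z<ys with shape-nonempty q
  ... | y , y∈ = <[]-trans o (All.lookup z<ys y∈) (All.lookup ys<x y∈)
prepend x (node {o} {l} {r} {xs} {ys} {i} p q s) | occurs x∈ = inj₂ (repeat (refl ∷ from∈ (∈-++⁺ʳ xs x∈)))
prepend x (node {o} {l} {r} {xs} {ys} {i} p q s) | straddle b<x x<a sub with shape-nonempty p
... | c , c∈ = inj₂ (cross (crossing (≪-lookup o s c∈ (All-⊆-last sub)) b<x x<a) (refl ∷ ++⁺ (from∈ c∈) sub))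
  where
  All-⊆-last : ∀ {a b ys} → a ∷ b ∷ [] ⊆ ys → b ∈ ys
  All-⊆-last (_ ∷ʳ q) = there (All-⊆-last q)
  All-⊆-last (_ ∷ q)  = there (to∈ q)

parse : ∀ x xs → Parse (x ∷ xs)
parse x []       = inj₁ (leaf , leaf x)
parse x (y ∷ ys) with parse y ys
... | inj₁ (_ , p) = prepend x p
... | inj₂ bad     = inj₂ (bad-⊆ (_ ∷ʳ ⊆-refl) bad)

-- Uniqueness of the tree of a word

data Overlap (as bs as′ bs′ : List ℕ) : Set where
  equal  : as ≡ as′ → bs ≡ bs′ → Overlap as bs as′ bs′
  longer : ∀ c cs → as ≡ as′ ++ c ∷ cs → bs′ ≡ c ∷ cs ++ bs → Overlap as bs as′ bs′
  shorter : ∀ c cs → as′ ≡ as ++ c ∷ cs → bs ≡ c ∷ cs ++ bs′ → Overlap as bs as′ bs′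

compareCuts : ∀ as {bs} as′ {bs′} → as ++ bs ≡ as′ ++ bs′ → Overlap as bs as′ bs′
compareCuts []       []         e = equal refl e
compareCuts []       (a′ ∷ as′) e = shorter a′ as′ refl e
compareCuts (a ∷ as) []         e = longer a as refl (sym e)
compareCuts (a ∷ as) (a′ ∷ as′) e with refl ← List.∷-injectiveˡ e with compareCuts as as′ (List.∷-injectiveʳ e)
... | equal refl refl       = equal refl refl
... | longer c cs refl f    = longer c cs refl f
... | shorter c cs refl f   = shorter c cs refl f

-- Two cuts of a list leave a common element on the left and a common one on the right.
≪-op-unique : ∀ o o′ {as bs as′ bs′} → as ++ bs ≡ as′ ++ bs′ →
  (∃ (_∈ as)) → (∃ (_∈ bs)) → (∃ (_∈ as′)) → (∃ (_∈ bs′)) → as ≪[ o ] bs → as′ ≪[ o′ ] bs′ → o ≡ o′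
≪-op-unique o o′ {as} {as′ = as′} e (a , a∈) (b , b∈) (a′ , a′∈) (b′ , b′∈) s s′ with compareCuts as as′ e
... | equal refl refl =
  <[]-unique o o′ (≪-lookup o s a∈ b∈) (≪-lookup o′ s′ a∈ b∈)
... | longer c cs refl refl =
  <[]-unique o o′ (≪-lookup o s (∈-++⁺ˡ a′∈) b∈) (≪-lookup o′ s′ a′∈ (∈-++⁺ʳ (c ∷ cs) b∈))
... | shorter c cs refl refl =
  <[]-unique o o′ (≪-lookup o s a∈ (∈-++⁺ʳ (c ∷ cs) b′∈)) (≪-lookup o′ s′ (∈-++⁺ˡ a∈) b′∈)

singleton-uncut : ∀ {x : ℕ} as {bs} → [ x ] ≡ as ++ bs → (∃ (_∈ as)) → ¬ (∃ (_∈ bs))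
singleton-uncut []           e    (_ , ()) _
singleton-uncut (a ∷ [])     refl _        (_ , ())
singleton-uncut (a ∷ _ ∷ as) ()   _        _

indec-unsplit : ∀ o {r zs} as {bs} → .(Indec o r) → Shape r zs → zs ≡ as ++ bs →
  (∃ (_∈ as)) → (∃ (_∈ bs)) → ¬ (as ≪[ o ] bs)
indec-unsplit o as i (leaf x) e a b s = singleton-uncut as e a b
indec-unsplit o as i (node {o = o′} p q s′) e a b s
  with ≪-op-unique o o′ (sym e) a b (shape-nonempty p) (shape-nonempty q) s s′ | indec-opp o o′ i
indec-unsplit ⊕ as i (node p q s′) e a b s | refl | ()
indec-unsplit ⊖ as i (node p q s′) e a b s | refl | ()

-- The roots agree by `≪-op-unique`. If the cuts differed, the longer right part would itself be an
-- `o`-sum, which `indec-unsplit` excludes.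
shape-unique : ∀ {t t′ zs zs′} → Shape t zs → Shape t′ zs′ → zs ≡ zs′ → t ≡ t′
shape-unique (leaf x) (leaf y) e = refl
shape-unique (leaf x) (node {xs = as} p q s) e =
  ⊥-elim (singleton-uncut as e (shape-nonempty p) (shape-nonempty q))
shape-unique (node {xs = as} p q s) (leaf x) e =
  ⊥-elim (singleton-uncut as (sym e) (shape-nonempty p) (shape-nonempty q))
shape-unique (node {o} {xs = as} {i = i} p q s) (node {o′} {xs = as′} {i = i′} p′ q′ s′) e
  with refl ← ≪-op-unique o o′ e (shape-nonempty p) (shape-nonempty q) (shape-nonempty p′) (shape-nonempty q′) s s′
  with compareCuts as as′ e
... | equal refl refl = node-cong (shape-unique p p′ refl) (shape-unique q q′ refl)
  where
  node-cong : ∀ {o l r l′ r′} .{i i′} → l ≡ l′ → r ≡ r′ → node o l r i ≡ node o l′ r′ i′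
  node-cong refl refl = refl
... | longer c cs refl refl =
  ⊥-elim (indec-unsplit o (c ∷ cs) i′ q′ refl (c , here refl) (shape-nonempty q) (All.++⁻ʳ as′ s))
... | shorter c cs refl refl =
  ⊥-elim (indec-unsplit o (c ∷ cs) i q refl (c , here refl) (shape-nonempty q′) (All.++⁻ʳ as s′))

-- Words with consecutive values

Within : ℕ → ℕ → List ℕ → Set
Within lo hi = All (λ z → lo ≤ z × z < hi)

between : ∀ {lo hi} as {bs} → ∃ (_∈ as) → as ≪[ ⊕ ] bs → Within lo hi as → Within lo hi bs →
  ∃ λ mid → Within lo mid as × Within mid hi bs
between as {bs} (a , a∈) s w w′ =
  -- The least bound above `as`. An entry of `as` below `b` gives `0 < b`, as the base value of
  -- `max` requires.
  suc (max 0 as) ,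
  All.zipWith (λ (p , q) → proj₁ p , s≤s q) (w , xs≤max 0 as) ,
  All.tabulate λ b∈ →
    max<v⁺ (≤-<-trans z≤n (≪-lookup ⊕ s a∈ b∈)) (All.map (λ s → All.lookup s b∈) s) , proj₂ (All.lookup w′ b∈)

pinch : ∀ {lo mid hi} m n → lo + m ≤ mid → mid + n ≤ hi →
  lo + (m + n) ≤ hi × (hi ≡ lo + (m + n) → mid ≡ lo + m × hi ≡ mid + n)
pinch {lo} {mid} {hi} m n p q = subst (_≤ hi) (+-assoc lo m n) (≤-trans (+-monoˡ-≤ n p) q) , λ e →
  let e′ = ≤-antisym (+-cancelʳ-≤ n mid (lo + m) (subst (mid + n ≤_) (trans e (sym (+-assoc lo m n))) q)) p
  in  e′ , trans e (trans (sym (+-assoc lo m n)) (cong (_+ n) (sym e′)))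

-- A pigeonhole argument along the tree: a word needs `size t` values, and in an interval with no
-- more than these every value is forced. Thus the word of a permutation is `ev 0` of its tree.
tight : ∀ {t zs lo hi} → Shape t zs → Within lo hi zs → lo + size t ≤ hi × (hi ≡ lo + size t → zs ≡ ev lo t)
tight {lo = lo} (leaf x) ((lo≤x , x<hi) ∷ []) =
  ≤-trans (≤-reflexive (+-comm lo 1)) (≤-trans (s≤s lo≤x) x<hi) ,
  λ e → cong [_] (≤-antisym (≤-pred (≤-trans x<hi (≤-reflexive (trans e (+-comm lo 1))))) lo≤x)
tight {lo = lo} (node {⊕} {l} {r} {xs} p q s) w
  with mid , wl , wr ← between xs (shape-nonempty p) s (All.++⁻ˡ xs w) (All.++⁻ʳ xs w)
  with b , f ← tight p wl | b′ , f′ ← tight q wr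
  with c , g ← pinch (size l) (size r) b b′ =
  c , λ e → let e₁ , e₂ = g e in
    cong₂ _++_ (f e₁) (trans (f′ e₂) (cong (λ m → ev m r) e₁))
tight {lo = lo} {hi} (node {⊖} {l} {r} {xs} {ys} p q s) w
  with mid , wr , wl ← between ys (shape-nonempty q) (All.tabulate λ b∈ → All.tabulate λ a∈ → ≪-lookup ⊖ s a∈ b∈)
                         (All.++⁻ʳ xs w) (All.++⁻ˡ xs w)
  with b , f ← tight p wl | b′ , f′ ← tight q wr
  with c , g ← pinch (size r) (size l) b′ b =
  subst (_≤ hi) (cong (lo +_) (+-comm (size r) (size l))) c ,
  λ e → let e₁ , e₂ = g (trans e (cong (lo +_) (+-comm (size l) (size r)))) in
    cong₂ _++_ (trans (f e₂) (cong (λ m → ev m l) e₁)) (f′ e₁)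

-- Trees of 312-avoiding words

data Is312 : List ℕ → Set where
  is312 : ∀ {z x y} → x < y → y < z → Is312 (z ∷ x ∷ y ∷ [])

-- Since 3 exceeds 1 and 2, no ⊕-cut splits 312. A ⊖-cut either leaves 12 on the right, where a
-- single leaf has no room, or separates 1 from 2, which are in the wrong order for it.
shape-¬312 : ∀ {t zs ws} → Shape t zs → SkewLeaf t → Is312 ws → ¬ (ws ⊆ zs)
shape-¬312 (leaf x) _ (is312 _ _) (_ ∷ʳ ())
shape-¬312 (leaf x) _ (is312 _ _) (refl ∷ ())
shape-¬312 (node {⊕} {xs = xs} p q s) (gl , gr) w sub with ⊆-++⁻ xs sub
... | []     , vs     , refl , _  , sv = shape-¬312 q gr w sv
... | us     , []     , refl , su , _  = shape-¬312 p gl (subst Is312 (List.++-identityʳ us) w) su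
shape-¬312 (node {⊕} p q s) _ (is312 xy yz) _ | z ∷ [] , _ ∷ _ , refl , su , sv with ≪-⊆ {⊕} s su sv
... | (zx ∷ _) ∷ _ = <-asym zx (<-trans xy yz)
shape-¬312 (node {⊕} p q s) _ (is312 xy yz) _ | z ∷ x ∷ [] , _ ∷ _ , refl , su , sv with ≪-⊆ {⊕} s su sv
... | (zy ∷ _) ∷ _ = <-asym zy yz
shape-¬312 (node {⊕} p q s) _ w _ | _ ∷ _ ∷ _ ∷ []    , _ ∷ _ , refl , _ , _ with () ← w
shape-¬312 (node {⊕} p q s) _ w _ | _ ∷ _ ∷ _ ∷ _ ∷ _ , _ ∷ _ , refl , _ , _ with () ← w
shape-¬312 (node {⊖} {xs = xs} p q s) (gl , refl) w sub with ⊆-++⁻ xs sub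
... | []     , vs     , refl , _  , sv = shape-¬312 q tt w sv
... | us     , []     , refl , su , _  = shape-¬312 p gl (subst Is312 (List.++-identityʳ us) w) su
shape-¬312 (node {⊖} p (leaf _) s) _ (is312 xy yz) _ | z ∷ [] , _ ∷ _ ∷ [] , refl , su , (_ ∷ʳ ())
shape-¬312 (node {⊖} p (leaf _) s) _ (is312 xy yz) _ | z ∷ [] , _ ∷ _ ∷ [] , refl , su , (_ ∷ ())
shape-¬312 (node {⊖} p q s) _ (is312 xy yz) _ | z ∷ x ∷ [] , _ ∷ _ , refl , su , sv with ≪-⊆ {⊖} s su sv
... | _ ∷ (yx ∷ _) ∷ _ = <-asym xy yx
shape-¬312 (node {⊖} p q s) _ w _ | _ ∷ _ ∷ _ ∷ []    , _ ∷ _ , refl , _ , _ with () ← w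
shape-¬312 (node {⊖} p q s) _ w _ | _ ∷ _ ∷ _ ∷ _ ∷ _ , _ ∷ _ , refl , _ , _ with () ← w

-- A ⊖-letter with several entries is a ⊕-node; an ascent across it, preceded by any entry of the
-- left child, is a 312.
shape-skewLeaf : ∀ {t zs} → Shape t zs → (∀ {ws} → Is312 ws → ¬ (ws ⊆ zs)) → SkewLeaf t
shape-skewLeaf (leaf x) _ = tt
shape-skewLeaf (node {⊕} {xs = xs} {ys} p q s) a =
  shape-skewLeaf p (λ w sub → a w (++⁺ʳ ys sub)) , shape-skewLeaf q (λ w sub → a w (++⁺ˡ xs sub))
shape-skewLeaf (node {⊖} {r = r} {xs = xs} {ys} {i} p q s) a =
  shape-skewLeaf p (λ w sub → a w (++⁺ʳ ys sub)) , right-leaf i q s a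
  where
  right-leaf : ∀ {r ys} → .(Indec ⊖ r) → Shape r ys → xs ≪[ ⊖ ] ys →
    (∀ {ws} → Is312 ws → ¬ (ws ⊆ xs ++ ys)) → r ≡ leaf
  right-leaf i (leaf _) s a = refl
  right-leaf i (node {⊕} {xs = as} p′ q′ s′) s a
    with z , z∈ ← shape-nonempty p | x , x∈ ← shape-nonempty p′ | y , y∈ ← shape-nonempty q′ =
    ⊥-elim (a (is312 (≪-lookup ⊕ s′ x∈ y∈) (≪-lookup ⊖ s z∈ (∈-++⁺ʳ as y∈)))
      (++⁺ (from∈ z∈) (++⁺ (from∈ x∈) (from∈ y∈))))

-- The statistics of a word read off its tree

-- At bs lo v: the bit of bs at index v − lo is set.
data At : List Bool → ℕ → ℕ → Set where
  here  : ∀ {bs v} → At (true ∷ bs) v v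
  there : ∀ {b bs lo v} → At bs (suc lo) v → At (b ∷ bs) lo v

at-++ˡ : ∀ {bs cs lo v} → At bs lo v → At (bs ++ cs) lo v
at-++ˡ here      = here
at-++ˡ (there p) = there (at-++ˡ p)

at-++ʳ : ∀ bs {cs lo v} → At cs (lo + length bs) v → At (bs ++ cs) lo v
at-++ʳ []       {cs} {lo} {v} p = subst (λ m → At cs m v) (+-identityʳ lo) p
at-++ʳ (b ∷ bs) {cs} {lo} {v} p = there (at-++ʳ bs (subst (λ m → At cs m v) (+-suc lo (length bs)) p))

at-++⁻ : ∀ bs {cs lo v} → At (bs ++ cs) lo v → At bs lo v ⊎ At cs (lo + length bs) v
at-++⁻ []       {cs} {lo} {v} p = inj₂ (subst (λ m → At cs m v) (sym (+-identityʳ lo)) p)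
at-++⁻ (b ∷ bs) here      = inj₁ here
at-++⁻ (b ∷ bs) {cs} {lo} {v} (there p) with at-++⁻ bs p
... | inj₁ q = inj₁ (there q)
... | inj₂ q = inj₂ (subst (λ m → At cs m v) (sym (+-suc lo (length bs))) q)

module _ (ρ : Op → Bool → Bool) where
  open Code ρ

  at-codeʳ : ∀ s t {cs lo v} → At cs (lo + size t) v → At (code s t ++ cs) lo v
  at-codeʳ s t {cs} {lo} {v} p = at-++ʳ (code s t) (subst (λ m → At cs (lo + m) v) (sym (length-code ρ s t)) p)

  at-code⁻ : ∀ s t {cs lo v} → At (code s t ++ cs) lo v → At (code s t) lo v ⊎ At cs (lo + size t) v
  at-code⁻ s t {cs} {lo} {v} p with at-++⁻ (code s t) p
  ... | inj₁ q = inj₁ q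
  ... | inj₂ q = inj₂ (subst (λ m → At cs (lo + m) v) (length-code ρ s t) q)

-- Left-to-right maxima (`⊕`) and minima (`⊖`)

data Record (o : Op) : List ℕ → ℕ → Set where
  here  : ∀ {v xs} → Record o (v ∷ xs) v
  there : ∀ {v x xs} → x <[ o ] v → Record o xs v → Record o (x ∷ xs) v

module _ {o : Op} where

  record-∈ : ∀ {xs v} → Record o xs v → v ∈ xs
  record-∈ here        = here refl
  record-∈ (there _ p) = there (record-∈ p)

  record-++ˡ : ∀ {xs ys v} → Record o xs v → Record o (xs ++ ys) v
  record-++ˡ here        = here
  record-++ˡ (there q p) = there q (record-++ˡ p)

  record-++ʳ : ∀ {xs ys v} → All (_<[ o ] v) xs → Record o ys v → Record o (xs ++ ys) v
  record-++ʳ []       p = p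
  record-++ʳ (q ∷ qs) p = there q (record-++ʳ qs p)

  record-++⁻ : ∀ xs {ys v} → Record o (xs ++ ys) v → Record o xs v ⊎ All (_<[ o ] v) xs × Record o ys v
  record-++⁻ []       p    = inj₂ ([] , p)
  record-++⁻ (x ∷ xs) here = inj₁ here
  record-++⁻ (x ∷ xs) (there q p) with record-++⁻ xs p
  ... | inj₁ r        = inj₁ (there q r)
  ... | inj₂ (qs , r) = inj₂ (q ∷ qs , r)

  record-≪ : ∀ {xs ys v} → xs ≪[ o ] ys → Record o ys v → Record o (xs ++ ys) v
  record-≪ s p = record-++ʳ (All.map (λ qs → All.lookup qs (record-∈ p)) s) p

  record-≪-opp : ∀ {xs ys v} → ∃ (_∈ xs) → xs ≪[ opp o ] ys → Record o (xs ++ ys) v → Record o xs v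
  record-≪-opp {xs} (x , x∈) s p with record-++⁻ xs p
  ... | inj₁ q        = q
  ... | inj₂ (qs , q) = ⊥-elim (<[]-asym o (All.lookup qs x∈) (<[]-opp⁻ o (≪-lookup (opp o) s x∈ (record-∈ q))))

-- The state says whether the `o`-records of a subtree are records of the whole word: the right
-- child of an `o`-node keeps this property, that of the opposite node loses it.
keepIf : Op → Op → Bool → Bool
keepIf ⊕ ⊕ b = b
keepIf ⊖ ⊖ b = b
keepIf _ _ _ = false

ev-∈ : ∀ lo t → ∃ (_∈ ev lo t)
ev-∈ lo t = shape-nonempty (shape-ev lo t)

module _ where
  open Code

  record⇒at : ∀ o lo t {v} → Record o (ev lo t) v → At (code (keepIf o) true t) lo v
  record⇒at o lo leaf here = here
  record⇒at ⊕ lo (node ⊕ l r _) p with record-++⁻ (ev lo l) p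
  ... | inj₁ q       = at-++ˡ (record⇒at ⊕ lo l q)
  ... | inj₂ (_ , q) = at-codeʳ _ true l (record⇒at ⊕ _ r q)
  record⇒at ⊕ lo (node ⊖ l r _) p =
    at-codeʳ _ false r (record⇒at ⊕ _ l (record-≪-opp (ev-∈ _ l) (⊖-≪ lo l r) p))
  record⇒at ⊖ lo (node ⊕ l r _) p =
    at-++ˡ (record⇒at ⊖ lo l (record-≪-opp (ev-∈ lo l) (⊕-≪ lo l r) p))
  record⇒at ⊖ lo (node ⊖ l r _) p with record-++⁻ (ev _ l) p
  ... | inj₁ q       = at-codeʳ _ true r (record⇒at ⊖ _ l q)
  ... | inj₂ (_ , q) = at-++ˡ (record⇒at ⊖ lo r q)

  -- Concluding `b ≡ true` as well lets the induction exclude set bits in the right child of an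
  -- opposite node, which is entered in state `false`.
  at⇒record : ∀ o lo b t {v} → At (code (keepIf o) b t) lo v → b ≡ true × Record o (ev lo t) v
  at⇒record o lo b leaf here = refl , here
  at⇒record ⊕ lo b (node ⊕ l r _) p with at-code⁻ _ b l p
  ... | inj₁ q = let e , q′ = at⇒record ⊕ lo b l q in e , record-++ˡ q′
  ... | inj₂ q = let e , q′ = at⇒record ⊕ _ b r q in e , record-≪ (⊕-≪ lo l r) q′
  at⇒record ⊕ lo b (node ⊖ l r _) p with at-code⁻ _ false r p
  ... | inj₁ q with () ← proj₁ (at⇒record ⊕ lo false r q)
  at⇒record ⊕ lo b (node ⊖ l r _) p | inj₂ q = let e , q′ = at⇒record ⊕ _ b l q in e , record-++ˡ q′
  at⇒record ⊖ lo b (node ⊕ l r _) p with at-code⁻ _ b l p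
  ... | inj₁ q = let e , q′ = at⇒record ⊖ lo b l q in e , record-++ˡ q′
  ... | inj₂ q with () ← proj₁ (at⇒record ⊖ _ false r q)
  at⇒record ⊖ lo b (node ⊖ l r _) p with at-code⁻ _ b r p
  ... | inj₁ q = let e , q′ = at⇒record ⊖ lo b r q in e , record-≪ (⊖-≪ lo l r) q′
  ... | inj₂ q = let e , q′ = at⇒record ⊖ _ b l q in e , record-++ˡ q′

-- Descent bottoms

-- Descent p xs v: v is a descent bottom of p ∷ xs.
data Descent : ℕ → List ℕ → ℕ → Set where
  here  : ∀ {p v xs} → v < p → Descent p (v ∷ xs) v
  there : ∀ {p x xs v} → Descent x xs v → Descent p (x ∷ xs) v

lastOr : ℕ → List ℕ → ℕ
lastOr p []       = p
lastOr p (x ∷ xs) = lastOr x xs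

lastOr-∈ : ∀ {p xs} → ∃ (_∈ xs) → lastOr p xs ∈ xs
lastOr-∈ {p} {x ∷ []}     _ = here refl
lastOr-∈ {p} {x ∷ y ∷ xs} _ = there (lastOr-∈ {x} {y ∷ xs} (y , here refl))

descent-++ˡ : ∀ {p xs ys v} → Descent p xs v → Descent p (xs ++ ys) v
descent-++ˡ (here q)  = here q
descent-++ˡ (there q) = there (descent-++ˡ q)

descent-++ʳ : ∀ {p} xs {ys v} → Descent (lastOr p xs) ys v → Descent p (xs ++ ys) v
descent-++ʳ []       q = q
descent-++ʳ (x ∷ xs) q = there (descent-++ʳ xs q)

descent-++⁻ : ∀ {p} xs {ys v} → Descent p (xs ++ ys) v → Descent p xs v ⊎ Descent (lastOr p xs) ys v
descent-++⁻ []       q        = inj₂ q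
descent-++⁻ (x ∷ xs) (here q) = inj₁ (here q)
descent-++⁻ (x ∷ xs) (there q) with descent-++⁻ xs q
... | inj₁ r = inj₁ (there r)
... | inj₂ r = inj₂ r

-- The state says whether the entry `p` just before a subtree lies above it, that is, whether the
-- subtree begins with a descent bottom. The weak inequality admits a fictitious `p = 0` before the
-- whole word.
Entered : Bool → ℕ → List ℕ → Set
Entered true  p xs = All (_< p) xs
Entered false p xs = All (p ≤_) xs

entered-++⁻ˡ : ∀ b {p} xs {ys} → Entered b p (xs ++ ys) → Entered b p xs
entered-++⁻ˡ true  xs e = All.++⁻ˡ xs e
entered-++⁻ˡ false xs e = All.++⁻ˡ xs e

isSkew : Op → Bool → Bool
isSkew ⊕ _ = false
isSkew ⊖ _ = true

⊕-entered : ∀ p lo l r → Entered false (lastOr p (ev lo l)) (ev (lo + size l) r)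
⊕-entered p lo l r = All.map <⇒≤ (All.lookup (⊕-≪ lo l r) (lastOr-∈ {p} (ev-∈ lo l)))

⊖-entered : ∀ p lo l r → Entered true (lastOr p (ev (lo + size r) l)) (ev lo r)
⊖-entered p lo l r = All.lookup (⊖-≪ lo l r) (lastOr-∈ {p} (ev-∈ _ l))

module _ where
  open Code isSkew

  descent⇒at : ∀ b p lo t {v} → Entered b p (ev lo t) → Descent p (ev lo t) v → At (code b t) lo v
  descent⇒at true  p lo leaf _       (here _) = here
  descent⇒at false p lo leaf (q ∷ _) (here r) = ⊥-elim (<⇒≱ r q)
  descent⇒at b     p lo (node ⊕ l r _) e d with descent-++⁻ (ev lo l) d
  ... | inj₁ q = at-++ˡ (descent⇒at b p lo l (entered-++⁻ˡ b (ev lo l) e) q)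
  ... | inj₂ q = at-codeʳ isSkew b l (descent⇒at false _ _ r (⊕-entered p lo l r) q)
  descent⇒at b     p lo (node ⊖ l r _) e d with descent-++⁻ (ev _ l) d
  ... | inj₁ q = at-codeʳ isSkew true r (descent⇒at b p _ l (entered-++⁻ˡ b (ev _ l) e) q)
  ... | inj₂ q = at-++ˡ (descent⇒at true _ lo r (⊖-entered p lo l r) q)

  at⇒descent : ∀ b p lo t {v} → Entered b p (ev lo t) → At (code b t) lo v → Descent p (ev lo t) v
  at⇒descent b p lo leaf (q ∷ _) here = here q
  at⇒descent b p lo (node ⊕ l r _) e a with at-code⁻ isSkew b l a
  ... | inj₁ q = descent-++ˡ (at⇒descent b p lo l (entered-++⁻ˡ b (ev lo l) e) q)
  ... | inj₂ q = descent-++ʳ (ev lo l) (at⇒descent false _ _ r (⊕-entered p lo l r) q)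
  at⇒descent b p lo (node ⊖ l r _) e a with at-code⁻ isSkew true r a
  ... | inj₁ q = descent-++ʳ (ev _ l) (at⇒descent true _ lo r (⊖-entered p lo l r) q)
  ... | inj₂ q = descent-++ˡ (at⇒descent b p _ l (entered-++⁻ˡ b (ev _ l) e) q)

-- Components

-- The number of indices k with max (m , 1 + xs₀ , …, 1 + xsₖ) ≤ 1 + i + k.
count : ℕ → ℕ → List ℕ → ℕ
count m i []       = 0
count m i (x ∷ xs) =
  (if does (m ⊔ suc x ≤? suc i) then 1 else 0) + count (m ⊔ suc x) (suc i) xs

count-blocked : ∀ {m i} xs {ys} → i + length xs < m → All (_< m) xs →
  count m i (xs ++ ys) ≡ count m (i + length xs) ys
count-blocked {m} {i} []       {ys} _ _ = cong (λ j → count m j ys) (sym (+-identityʳ i))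
count-blocked {m} {i} (x ∷ xs) {ys} p (x<m ∷ a)
  rewrite m≥n⇒m⊔n≡m x<m
        | +-suc i (length xs)
        | dec-false (m ≤? suc i) (<⇒≱ (≤-<-trans (s≤s (m≤m+n i (length xs))) p)) = count-blocked xs p a

count-reached : ∀ {m i} xs {ys} → ∃ (_∈ xs) → i + length xs ≡ m → All (_< m) xs →
  count m i (xs ++ ys) ≡ suc (count m m ys)
count-reached {m} {i} (x ∷ []) _ e (x<m ∷ [])
  rewrite m≥n⇒m⊔n≡m x<m | dec-true (m ≤? suc i) (≤-reflexive (trans (sym e) (+-comm i 1))) | +-comm i 1 | e = refl
count-reached {m} {i} (x ∷ y ∷ xs) _ e (x<m ∷ a)
  rewrite m≥n⇒m⊔n≡m x<m
        | dec-false (m ≤? suc i) (<⇒≱ (subst (suc i <_) (trans (sym (+-suc i _)) e) (m<m+n (suc i) (s≤s z≤n)))) =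
  count-reached (y ∷ xs) (y , here refl) (trans (sym (+-suc i _)) e) a

-- Positions that start below `lo` never catch up with values from `lo` on, so no index of the block
-- is counted.
count-raised : ∀ {m i} lo t {ys} → i < lo → m ≤ lo →
  count m i (ev lo t ++ ys) ≡ count (lo + size t) (i + size t) ys
count-raised {m} {i} lo leaf p q
  rewrite m≤n⇒m⊔n≡n (m≤n⇒m≤1+n q) | dec-false (suc lo ≤? suc i) (<⇒≱ (s≤s p)) | +-comm lo 1 | +-comm i 1 = refl
count-raised {m} {i} lo (node ⊕ l r _) {ys} p q
  rewrite List.++-assoc (ev lo l) (ev (lo + size l) r) ys
        | count-raised {m} {i} lo l {ev (lo + size l) r ++ ys} p q
        | count-raised {lo + size l} {i + size l} (lo + size l) r {ys} (+-monoˡ-< (size l) p) ≤-refl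
        | +-assoc lo (size l) (size r) | +-assoc i (size l) (size r) = refl
count-raised {m} {i} lo (node ⊖ l r _) {ys} p q = begin
  count m i ((ev (lo + size r) l ++ ev lo r) ++ ys)
    ≡⟨ cong (count m i) (List.++-assoc (ev (lo + size r) l) _ ys) ⟩
  count m i (ev (lo + size r) l ++ ev lo r ++ ys)
    ≡⟨ count-raised (lo + size r) l (≤-trans p (m≤m+n lo _)) (≤-trans q (m≤m+n lo _)) ⟩
  count (lo + size r + size l) (i + size l) (ev lo r ++ ys)
    ≡⟨ count-blocked (ev lo r)
         (subst (_< lo + size r + size l) (sym i+≡) (subst (i + (size l + size r) <_) lo+≡ (+-monoˡ-< _ p)))
         (All.map (λ x< → <-≤-trans x< (m≤m+n (lo + size r) (size l))) (ev-< lo r)) ⟩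
  count (lo + size r + size l) (i + size l + length (ev lo r)) ys
    ≡⟨ cong₂ (λ a b → count a b ys) (sym lo+≡) i+≡ ⟩
  count (lo + (size l + size r)) (i + (size l + size r)) ys ∎
  where
  open ≡-Reasoning
  lo+≡ : lo + (size l + size r) ≡ lo + size r + size l
  lo+≡ = trans (cong (lo +_) (+-comm (size l) _)) (sym (+-assoc lo _ _))
  i+≡ : i + size l + length (ev lo r) ≡ i + (size l + size r)
  i+≡ = trans (cong (i + size l +_) (length-ev lo r)) (+-assoc i _ _)

components : Tree → ℕ
components leaf           = 1
components (node ⊕ l r _) = components l + components r
components (node ⊖ l r _) = 1

components-indec : ∀ t → .(Indec ⊕ t) → components t ≡ 1
components-indec leaf           _ = refl
components-indec (node ⊖ _ _ _) _ = refl

length-comps : ∀ t cs → length (comps t cs) ≡ components t + length cs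
length-comps leaf           cs = refl
length-comps (node ⊕ l r i) cs =
  trans (length-comps l _)
    (trans (cong (λ c → components l + (c + length cs)) (sym (components-indec r i))) (sym (+-assoc (components l) _ _)))
length-comps (node ⊖ l r i) cs = refl

-- At a ⊖-node the left part comes first and has the larger values, which keeps the maximum ahead of
-- the position; only the end of the right part closes the gap, so the node counts once. At a ⊕-node
-- the counts add up.
count-ev : ∀ {m} lo t {ys} → m ≤ lo →
  count m lo (ev lo t ++ ys) ≡ components t + count (lo + size t) (lo + size t) ys
count-ev {m} lo leaf q
  rewrite m≤n⇒m⊔n≡n (m≤n⇒m≤1+n q) | dec-true (suc lo ≤? suc lo) ≤-refl | +-comm lo 1 = refl
count-ev {m} lo (node ⊕ l r _) {ys} q
  rewrite List.++-assoc (ev lo l) (ev (lo + size l) r) ys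
        | count-ev {m} lo l {ev (lo + size l) r ++ ys} q
        | count-ev {lo + size l} (lo + size l) r {ys} ≤-refl
        | +-assoc lo (size l) (size r) = sym (+-assoc (components l) _ _)
count-ev {m} lo (node ⊖ l r _) {ys} q = begin
  count m lo ((ev (lo + size r) l ++ ev lo r) ++ ys)
    ≡⟨ cong (count m lo) (List.++-assoc (ev (lo + size r) l) _ ys) ⟩
  count m lo (ev (lo + size r) l ++ ev lo r ++ ys)
    ≡⟨ count-raised (lo + size r) l (m<m+n lo (size-pos r)) (≤-trans q (m≤m+n lo _)) ⟩
  count (lo + size r + size l) (lo + size l) (ev lo r ++ ys)
    ≡⟨ cong (λ a → count a (lo + size l) (ev lo r ++ ys)) (sym lo+≡) ⟩
  count (lo + (size l + size r)) (lo + size l) (ev lo r ++ ys)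
    ≡⟨ count-reached (ev lo r) (ev-∈ lo r) (trans (cong (lo + size l +_) (length-ev lo r)) (+-assoc lo _ _))
         (All.map (λ x< → <-≤-trans x< (+-monoʳ-≤ lo (m≤n+m (size r) _))) (ev-< lo r)) ⟩
  suc (count (lo + (size l + size r)) (lo + (size l + size r)) ys) ∎
  where
  open ≡-Reasoning
  lo+≡ : lo + (size l + size r) ≡ lo + size r + size l
  lo+≡ = trans (cong (lo +_) (+-comm (size l) _)) (sym (+-assoc lo _ _))

count-ncomp : ∀ t → count 0 0 (ev 0 t) ≡ ncomp t
count-ncomp t =
  trans (cong (count 0 0) (sym (List.++-identityʳ (ev 0 t)))) (trans (count-ev 0 t z≤n) (sym (length-comps t [])))

-- Permutations

word : ∀ {n} → Perm n → List ℕ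
word π = tabulate (λ i → toℕ (π i))

fromWord : ∀ {n} xs → length xs ≡ n → All (_< n) xs → Perm n
fromWord xs refl a i = fromℕ< (All.lookup a (∈-lookup i))

word-fromWord : ∀ {n} xs (e : length xs ≡ n) a → word (fromWord xs e a) ≡ xs
word-fromWord xs refl a = trans (List.tabulate-cong (λ i → Fin.toℕ-fromℕ< _)) (List.tabulate-lookup xs)

word-injective : ∀ {n} (π σ : Perm n) → word π ≡ word σ → ∀ i → π i ≡ σ i
word-injective {suc n} π σ e zero    = Fin.toℕ-injective (List.∷-injectiveˡ e)
word-injective {suc n} π σ e (suc i) =
  Fin.toℕ-injective (pointwise (toℕ ∘ π) (toℕ ∘ σ) e (suc i))
  where
  pointwise : ∀ {n} (f g : Fin n → ℕ) → tabulate f ≡ tabulate g → ∀ i → f i ≡ g i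
  pointwise f g e zero    = List.∷-injectiveˡ e
  pointwise f g e (suc i) = pointwise (f ∘ suc) (g ∘ suc) (List.∷-injectiveʳ e) i

-- Occurrences of patterns as sublists

Increasing : ∀ {n} → List (Fin n) → Set
Increasing = AllPairs Fin._<_

zero-increasing : ∀ {n} {ps : List (Fin n)} → Increasing ps → Increasing (zero ∷ List.map suc ps)
zero-increasing inc = All.map⁺ (All.tabulate (λ _ → s≤s z≤n)) ∷ AllPairs.map⁺ (AllPairs.map s≤s inc)

-- Together with `subword` this translates between sublists of a word and the position maps in
-- `Contains`.
positions : ∀ {n} (f : Fin n → ℕ) {ws} → ws ⊆ tabulate f → ∃ λ ps → Increasing ps × List.map f ps ≡ ws
positions {zero}  f [] = [] , [] , refl
positions {suc n} f (_ ∷ʳ p) with positions (f ∘ suc) p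
... | ps , inc , e = List.map suc ps , AllPairs.map⁺ (AllPairs.map s≤s inc) , trans (sym (List.map-∘ ps)) e
positions {suc n} f (refl ∷ p) with positions (f ∘ suc) p
... | ps , inc , e = zero ∷ List.map suc ps , zero-increasing inc , cong (f zero ∷_) (trans (sym (List.map-∘ ps)) e)

predecessors : ∀ {n} {ps : List (Fin (suc n))} → All (λ p → 0 < toℕ p) ps → ∃ λ qs → ps ≡ List.map suc qs
predecessors []                        = [] , refl
predecessors (_∷_ {x = suc p} _ a) with predecessors a
... | qs , refl = p ∷ qs , refl

increasing-suc⁻ : ∀ {n} (qs : List (Fin n)) → Increasing (List.map Fin.suc qs) → Increasing qs
increasing-suc⁻ []       []       = []
increasing-suc⁻ (q ∷ qs) (a ∷ as) = All.map ≤-pred (All.map⁻ a) ∷ increasing-suc⁻ qs as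

subword : ∀ {n} (f : Fin n → ℕ) ps → Increasing ps → List.map f ps ⊆ tabulate f
subword         f []           _         = minimum _
subword {suc n} f (zero ∷ ps)  (a ∷ inc) with predecessors a
... | qs , refl =
  refl ∷ subst (_⊆ tabulate (f ∘ suc)) (List.map-∘ qs) (subword (f ∘ suc) qs (increasing-suc⁻ qs inc))
subword {suc n} f (suc p ∷ ps) (a ∷ inc) with predecessors (All.map (≤-trans (s≤s z≤n)) a)
... | qs , refl =
  f zero ∷ʳ subst (_⊆ tabulate (f ∘ suc)) (List.map-∘ (p ∷ qs))
    (subword (f ∘ suc) (p ∷ qs) (increasing-suc⁻ (p ∷ qs) (a ∷ inc)))

module _ {A : Set} {R : A → A → Set} where

  lookup-pairs : ∀ {xs} → AllPairs R xs → ∀ a b → toℕ a < toℕ b → R (List.lookup xs a) (List.lookup xs b)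
  lookup-pairs (rs ∷ _) zero    (suc b) _       = All.lookup rs (∈-lookup b)
  lookup-pairs (_ ∷ ps) (suc a) (suc b) (s≤s p) = lookup-pairs ps a b p

lookup-<-⇔ : ∀ {us} → AllPairs _<_ us → ∀ a b → toℕ a < toℕ b ⇔ List.lookup us a < List.lookup us b
lookup-<-⇔ {us} s a b = mk⇔ (lookup-pairs s a b) reflects
  where
  reflects : List.lookup us a < List.lookup us b → toℕ a < toℕ b
  reflects p with <-cmp (toℕ a) (toℕ b)
  ... | tri< q _ _ = q
  ... | tri≈ _ q _ with refl ← Fin.toℕ-injective q = ⊥-elim (<-irrefl refl p)
  ... | tri> _ _ q = ⊥-elim (<-asym p (lookup-pairs s b a q))

-- us is the sorted list of the values of the occurrence, so σ a is the rank of the a-th value.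
occurs-at : ∀ {n} {π : Perm n} ps → Increasing ps → ∀ us (σ : Fin (length ps) → Fin (length us)) → AllPairs _<_ us →
  (∀ a → toℕ (π (List.lookup ps a)) ≡ List.lookup us (σ a)) →
  Σ (Fin (length ps) → Fin n) λ f →
    (∀ a b → toℕ a < toℕ b → toℕ (f a) < toℕ (f b)) ×
    (∀ a b → (toℕ (σ a) < toℕ (σ b)) ⇔ (toℕ (π (f a)) < toℕ (π (f b))))
occurs-at ps inc us σ s h = List.lookup ps , lookup-pairs inc , λ a b →
  subst₂ (λ x y → toℕ (σ a) < toℕ (σ b) ⇔ x < y) (sym (h a)) (sym (h b)) (lookup-<-⇔ s (σ a) (σ b))

crossing⇒contains : ∀ {n} (π : Perm n) {o ws} → Crossing o ws → ws ⊆ word π → Contains π p2413 ⊎ Contains π p3142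
crossing⇒contains π {o} c sub with positions (toℕ ∘ π) sub
crossing⇒contains π {⊕} (crossing cb bx xa) sub | ps@(_ ∷ _ ∷ _ ∷ _ ∷ []) , inc , refl =
  -- The entries of the crossing `x c a b` are, in increasing order, `c b x a` here and `a x b c`
  -- for `⊖`.
  inj₂ (occurs-at {π = π} ps inc (_ ∷ _ ∷ _ ∷ _ ∷ []) p3142
    ((cb ∷ <-trans cb bx ∷ <-trans cb (<-trans bx xa) ∷ []) ∷ (bx ∷ <-trans bx xa ∷ []) ∷ (xa ∷ []) ∷ [] ∷ [])
    λ { zero → refl ; (suc zero) → refl ; (suc (suc zero)) → refl ; (suc (suc (suc zero))) → refl })
crossing⇒contains π {⊖} (crossing bc xb ax) sub | ps@(_ ∷ _ ∷ _ ∷ _ ∷ []) , inc , refl =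
  inj₁ (occurs-at {π = π} ps inc (_ ∷ _ ∷ _ ∷ _ ∷ []) p2413
    ((ax ∷ <-trans ax xb ∷ <-trans ax (<-trans xb bc) ∷ []) ∷ (xb ∷ <-trans xb bc ∷ []) ∷ (bc ∷ []) ∷ [] ∷ [])
    λ { zero → refl ; (suc zero) → refl ; (suc (suc zero)) → refl ; (suc (suc (suc zero))) → refl })

312⇒contains : ∀ {n} (π : Perm n) {ws} → Is312 ws → ws ⊆ word π → Contains π p312
312⇒contains π w sub with positions (toℕ ∘ π) sub
312⇒contains π (is312 xy yz) sub | ps@(_ ∷ _ ∷ _ ∷ []) , inc , refl =
  occurs-at {π = π} ps inc (_ ∷ _ ∷ _ ∷ []) p312 ((xy ∷ <-trans xy yz ∷ []) ∷ (yz ∷ []) ∷ [] ∷ [])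
    λ { zero → refl ; (suc zero) → refl ; (suc (suc zero)) → refl }

occurrence : ∀ {n k} (π : Perm n) (f : Fin k → Fin n) → (∀ a b → toℕ a < toℕ b → toℕ (f a) < toℕ (f b)) →
  List.map (toℕ ∘ π) (tabulate f) ⊆ word π
occurrence π f mono = subword (toℕ ∘ π) (tabulate f) (AllPairs.tabulate⁺-< (λ {i} {j} → mono i j))

shape⇒isPerm : ∀ {n} (π : Perm n) {t} → Shape t (word π) → IsPerm π
shape⇒isPerm π s {i} {j} e with <-cmp (toℕ i) (toℕ j)
... | tri≈ _ p _ = Fin.toℕ-injective p
... | tri< p _ _ = ⊥-elim (shape-¬repeat s
  (subst (λ v → toℕ (π i) ∷ toℕ v ∷ [] ⊆ word π) (sym e) (subword (toℕ ∘ π) (i ∷ j ∷ []) ((p ∷ []) ∷ [] ∷ []))))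
... | tri> _ _ p = ⊥-elim (shape-¬repeat s
  (subst (λ v → toℕ (π j) ∷ toℕ v ∷ [] ⊆ word π) e (subword (toℕ ∘ π) (j ∷ i ∷ []) ((p ∷ []) ∷ [] ∷ []))))

shape⇒sep : ∀ {n} (π : Perm n) {t} → Shape t (word π) → InSep π
shape⇒sep π s = shape⇒isPerm π s ,
  (λ (f , mono , h) → shape-¬crossing {o = ⊖} s
    (crossing (to (h (# 3) (# 1)) (s≤s (s≤s (s≤s z≤n)))) (to (h (# 0) (# 3)) (s≤s (s≤s z≤n)))
      (to (h (# 2) (# 0)) (s≤s z≤n)))
    (occurrence π f mono)) ,
  (λ (f , mono , h) → shape-¬crossing {o = ⊕} s
    (crossing (to (h (# 1) (# 3)) (s≤s z≤n)) (to (h (# 3) (# 0)) (s≤s (s≤s z≤n)))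
      (to (h (# 0) (# 2)) (s≤s (s≤s (s≤s z≤n)))))
    (occurrence π f mono))

shape⇒312 : ∀ {n} (π : Perm n) {t} → Shape t (word π) → SkewLeaf t → In312 π
shape⇒312 π s g = shape⇒isPerm π s , λ (f , mono , h) →
  shape-¬312 s g (is312 (to (h (# 1) (# 2)) (s≤s z≤n)) (to (h (# 2) (# 0)) (s≤s (s≤s z≤n)))) (occurrence π f mono)

repeat-¬perm : ∀ {n} (π : Perm n) {x} → IsPerm π → ¬ (x ∷ x ∷ [] ⊆ word π)
repeat-¬perm π inj sub with positions (toℕ ∘ π) sub
... | i ∷ j ∷ [] , (i<j ∷ []) ∷ _ , e
  with refl ← inj (Fin.toℕ-injective (trans (List.∷-injectiveˡ e) (sym (List.∷-injectiveˡ (List.∷-injectiveʳ e))))) =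
  <-irrefl refl i<j

-- 3142 contains 312 as its entries 3, 1, 2 and 2413 as its entries 4, 1, 3; hence 312-avoiders have
-- trees.
crossing-312 : ∀ {o ws} → Crossing o ws → ∃ λ vs → Is312 vs × vs ⊆ ws
crossing-312 {⊕} (crossing cb bx xa) = _ , is312 cb bx , refl ∷ refl ∷ _ ∷ʳ refl ∷ []
crossing-312 {⊖} (crossing bc xb ax) = _ , is312 (<-trans ax xb) bc , _ ∷ʳ refl ∷ refl ∷ refl ∷ []

sep-¬bad : ∀ {n} (π : Perm n) → InSep π → ¬ Bad (word π)
sep-¬bad π (inj , _ , _)   (repeat sub)  = repeat-¬perm π inj sub
sep-¬bad π (_ , a , a′)    (cross c sub) with crossing⇒contains π c sub
... | inj₁ p = a p
... | inj₂ p = a′ p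

312-¬bad : ∀ {n} (π : Perm n) → In312 π → ¬ Bad (word π)
312-¬bad π (inj , _) (repeat sub) = repeat-¬perm π inj sub
312-¬bad π (_ , a) (cross c sub) with crossing-312 c
... | _ , w , sub′ = a (312⇒contains π w (⊆-trans sub′ sub))

-- Statistics of permutations and of their words

module _ (o : Op) where

  IsRecord : ∀ {n} → (Fin n → ℕ) → ℕ → Set
  IsRecord f w = ∃ λ i → f i ≡ w × (∀ j → toℕ j < toℕ i → f j <[ o ] f i)

  record⇒ : ∀ {n} (f : Fin n → ℕ) {w} → Record o (tabulate f) w → IsRecord f w
  record⇒ {suc n} f here        = zero , refl , λ _ ()
  record⇒ {suc n} f (there q p) with record⇒ (f ∘ suc) p
  ... | i , refl , h = suc i , refl , λ { zero _ → q ; (suc j) (s≤s j<i) → h j j<i }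

  ⇒record : ∀ {n} (f : Fin n → ℕ) {w} → IsRecord f w → Record o (tabulate f) w
  ⇒record {suc n} f (zero  , refl , h) = here
  ⇒record {suc n} f (suc i , refl , h) =
    there (h zero (s≤s z≤n)) (⇒record (f ∘ suc) (i , refl , λ j j<i → h (suc j) (s≤s j<i)))

IsDescent : ∀ {n} → (Fin n → ℕ) → ℕ → Set
IsDescent f w = ∃ λ i → ∃ λ j → toℕ j ≡ suc (toℕ i) × f j < f i × f j ≡ w

descent⇒ : ∀ {n} (f : Fin (suc n) → ℕ) {w} → Descent (f zero) (tabulate (f ∘ suc)) w → IsDescent f w
descent⇒ {suc n} f (here q)  = zero , suc zero , refl , q , refl
descent⇒ {suc n} f (there p) with descent⇒ (f ∘ suc) p
... | i , j , e , q , r = suc i , suc j , cong suc e , q , r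

⇒descent : ∀ {n} (f : Fin (suc n) → ℕ) {w} → IsDescent f w → Descent (f zero) (tabulate (f ∘ suc)) w
⇒descent {suc n} f (zero  , suc zero , e  , q , refl) = here q
⇒descent {suc n} f (suc i , suc j    , e  , q , r)    = there (⇒descent (f ∘ suc) (i , j , suc-injective e , q , r))

descent₀⇔ : ∀ {n} (f : Fin n → ℕ) w → Descent 0 (tabulate f) w ⇔ IsDescent f w
descent₀⇔ {zero}  f w = mk⇔ (λ ()) (λ ())
descent₀⇔ {suc n} f w = mk⇔ (λ { (there d) → descent⇒ f d }) (there ∘ ⇒descent f)

-- Generalised for the induction: `i₀` entries have been read, and `m` is one more than the largest
-- of them, or 0 at the start.
count-tabulate : ∀ {A : Set} {Q : A → Set} (Q? : Decidable Q) {n} (g : Fin n → A) (f : Fin n → ℕ) m i₀ →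
  (∀ i → Q (g i) ⇔ (m ≤ suc (i₀ + toℕ i) × (∀ j → toℕ j ≤ toℕ i → f j ≤ i₀ + toℕ i))) →
  length (filter Q? (tabulate g)) ≡ count m i₀ (tabulate f)
count-tabulate Q? {zero}  g f m i₀ h = refl
count-tabulate {Q = Q} Q? {suc n} g f m i₀ h = head-step (Q? (g zero))
  where
  later : ∀ i → Q (g (suc i)) ⇔
    (m ⊔ suc (f zero) ≤ suc (suc i₀ + toℕ i) × (∀ j → toℕ j ≤ toℕ i → f (suc j) ≤ suc i₀ + toℕ i))
  later i = mk⇔
    (λ q → let p , b = to (h (suc i)) q in
      ⊔-lub (subst (λ k → m ≤ suc k) (+-suc i₀ _) p) (s≤s (subst (f zero ≤_) (+-suc i₀ _) (b zero z≤n))) ,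
      λ j j≤i → subst (f (suc j) ≤_) (+-suc i₀ _) (b (suc j) (s≤s j≤i)))
    (λ (p , b) → from (h (suc i))
      (subst (λ k → m ≤ suc k) (sym (+-suc i₀ _)) (m⊔n≤o⇒m≤o m _ p) ,
       λ { zero    _         → subst (f zero ≤_) (sym (+-suc i₀ _)) (≤-pred (m⊔n≤o⇒n≤o m _ p))
         ; (suc j) (s≤s j≤i) → subst (f (suc j) ≤_) (sym (+-suc i₀ _)) (b j j≤i) }))

  now : Q (g zero) ⇔ (m ⊔ suc (f zero) ≤ suc i₀)
  now = mk⇔
    (λ q → let p , b = to (h zero) q in
      ⊔-lub (subst (λ k → m ≤ suc k) (+-identityʳ i₀) p) (s≤s (subst (f zero ≤_) (+-identityʳ i₀) (b zero z≤n))))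
    (λ p → from (h zero)
      (subst (λ k → m ≤ suc k) (sym (+-identityʳ i₀)) (m⊔n≤o⇒m≤o m _ p) ,
       λ { zero _ → subst (f zero ≤_) (sym (+-identityʳ i₀)) (≤-pred (m⊔n≤o⇒n≤o m _ p)) }))

  rest : length (filter Q? (tabulate (g ∘ suc))) ≡ count (m ⊔ suc (f zero)) (suc i₀) (tabulate (f ∘ suc))
  rest = count-tabulate Q? (g ∘ suc) (f ∘ suc) _ (suc i₀) later

  head-step : Dec (Q (g zero)) → length (filter Q? (tabulate g)) ≡ count m i₀ (tabulate f)
  head-step (yes q)
    rewrite dec-true (Q? (g zero)) q | dec-true (m ⊔ suc (f zero) ≤? suc i₀) (to now q) = cong suc rest
  head-step (no ¬q)
    rewrite dec-false (Q? (g zero)) ¬q | dec-false (m ⊔ suc (f zero) ≤? suc i₀) (¬q ∘ from now) = rest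

comp-count : ∀ {n} (π : Perm n) → comp π ≡ count 0 0 (word π)
comp-count π = count-tabulate _ id (toℕ ∘ π) 0 0 (λ i → mk⇔ (λ h → z≤n , h) proj₂)

module _ {n} (π : Perm n) (t : Tree) (e : word π ≡ ev 0 t) where

  comp-ncomp : comp π ≡ ncomp t
  comp-ncomp = trans (comp-count π) (trans (cong (count 0 0) e) (count-ncomp t))

  iar-iarT : iar π ≡ iarT t
  iar-iarT = cong iarList e

  record-at : ∀ o v → (∃ λ i → π i ≡ v × (∀ j → toℕ j < toℕ i → toℕ (π j) <[ o ] toℕ (π i))) ⇔
    At (Code.code (keepIf o) true t) 0 (toℕ v)
  record-at o v = mk⇔
    (λ (i , p , h) → record⇒at o 0 t (subst R e (⇒record o (toℕ ∘ π) (i , cong toℕ p , h))))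
    (λ a → let i , p , h = record⇒ o (toℕ ∘ π) (subst R (sym e) (proj₂ (at⇒record o 0 true t a)))
           in i , Fin.toℕ-injective p , h)
    where
    R : List ℕ → Set
    R xs = Record o xs (toℕ v)

  desb-at : ∀ v → InDESB π v ⇔ At (Code.code isSkew false t) 0 (toℕ v)
  desb-at v = mk⇔
    (λ (i , j , p , q , r) →
      descent⇒at false 0 0 t (ev-≥ 0 t) (subst D e (from (descent₀⇔ (toℕ ∘ π) (toℕ v)) (i , j , p , q , cong toℕ r))))
    (λ a → let d = at⇒descent false 0 0 t (ev-≥ 0 t) a
               i , j , p , q , r = to (descent₀⇔ (toℕ ∘ π) (toℕ v)) (subst D (sym e) d)
           in i , j , p , q , Fin.toℕ-injective r)
    where
    D : List ℕ → Set
    D xs = Descent 0 xs (toℕ v)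

-- The involution on permutations

fromTree : ∀ {n} t → size t ≡ n → Perm n
fromTree t e = fromWord (ev 0 t) (trans (length-ev 0 t) e) (subst (λ m → All (_< m) (ev 0 t)) e (ev-< 0 t))

word-fromTree : ∀ {n} t (e : size t ≡ n) → word (fromTree t e) ≡ ev 0 t
word-fromTree t e =
  word-fromWord (ev 0 t) (trans (length-ev 0 t) e) (subst (λ m → All (_< m) (ev 0 t)) e (ev-< 0 t))

size-shape : ∀ {n t} (π : Perm n) → Shape t (word π) → size t ≡ n
size-shape π s = trans (sym (shape-length s)) (List.length-tabulate (toℕ ∘ π))

word-shape : ∀ {n t} (π : Perm n) → Shape t (word π) → word π ≡ ev 0 t
word-shape {n} π s = proj₂ (tight s (All.tabulate⁺ (λ i → z≤n , Fin.toℕ<n (π i)))) (sym (size-shape π s))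

parseWord : ∀ {m} (π : Perm (suc m)) → Parse (word π)
parseWord π = parse _ _

-- The identity is the default on permutations without a tree.
involve : ∀ {n} (π : Perm n) → Parse (word π) → Perm n
involve {n} π (inj₁ (t , s)) = fromTree (φ n t) (trans (size-φ n t) (size-shape π s))
involve     π (inj₂ _)       = π

-- By `shape-unique` any tree of the word is the one that the parser found.
word-involve : ∀ {n} (π : Perm n) (p : Parse (word π)) {t} → Shape t (word π) → word (involve π p) ≡ ev 0 (φ n t)
word-involve {n} π (inj₁ (t′ , s′)) s =
  trans (word-fromTree (φ n t′) _) (cong (ev 0 ∘ φ n) (shape-unique s′ s refl))
word-involve π (inj₂ bad) s = ⊥-elim (shape-¬bad s bad)

Φ : ∀ {m} → Perm (suc m) → Perm (suc m)
Φ π = involve π (parseWord π)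

transport : ∀ {A B : Set} {bs cs lo v} → A ⇔ At bs lo v → B ⇔ At cs lo v → bs ≡ cs → A ⇔ B
transport a b refl = mk⇔ (from b ∘ to a) (from a ∘ to b)

shape-of : ∀ {n} (π : Perm n) → Parse (word π) → ¬ Bad (word π) → ∃ λ t → Shape t (word π)
shape-of π (inj₁ p)   _    = p
shape-of π (inj₂ bad) ¬bad = ⊥-elim (¬bad bad)

module _ {m} (π : Perm (suc m)) {t} (s : Shape t (word π)) where
  private
    n = suc m
    t′ = φ n t
    w = word-shape π s

    w′ : word (Φ π) ≡ ev 0 t′
    w′ = word-involve π (parseWord π) s

    s′ : Shape t′ (word (Φ π))
    s′ = subst (Shape t′) (sym w′) (shape-ev 0 t′)

    swaps : Swaps (iarT t) (ncomp t) t′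
    swaps = φ-swaps n t (≤-reflexive (size-shape π s))

  Φ-sep : InSep (Φ π)
  Φ-sep = shape⇒sep (Φ π) s′

  Φ-involutive : ∀ i → Φ (Φ π) i ≡ π i
  Φ-involutive = word-injective (Φ (Φ π)) π
    (trans (word-involve (Φ π) (parseWord (Φ π)) s′) (trans (cong (ev 0) (φ-involutive n t)) (sym w)))

  Φ-record : ∀ o → (∀ b → keepIf o ⊕ (keepIf o ⊕ b) ≡ keepIf o ⊕ b) → ∀ v →
    (∃ λ i → Φ π i ≡ v × (∀ j → toℕ j < toℕ i → toℕ (Φ π j) <[ o ] toℕ (Φ π i))) ⇔
    (∃ λ i → π i ≡ v × (∀ j → toℕ j < toℕ i → toℕ (π j) <[ o ] toℕ (π i)))
  Φ-record o idem v =
    transport (record-at (Φ π) t′ w′ o v) (record-at π t w o v) (Code.code-φ (keepIf o) idem n true t)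

  Φ-desb : ∀ v → InDESB (Φ π) v ⇔ InDESB π v
  Φ-desb v = transport (desb-at (Φ π) t′ w′ v) (desb-at π t w v) (Code.code-φ isSkew (λ _ → refl) n false t)

  Φ-comp : comp (Φ π) ≡ iar π
  Φ-comp = trans (comp-ncomp (Φ π) t′ w′) (trans (proj₁ swaps) (sym (iar-iarT π t w)))

  Φ-iar : iar (Φ π) ≡ comp π
  Φ-iar = trans (iar-iarT (Φ π) t′ w′) (trans (proj₂ swaps) (sym (comp-ncomp π t w)))

  Φ-312 : (∀ {ws} → Is312 ws → ¬ (ws ⊆ word π)) → In312 (Φ π)
  Φ-312 a = shape⇒312 (Φ π) s′ (skewLeaf-φ n t (shape-skewLeaf s a))

theorem1p2 : (n : ℕ) → 1 ≤ n →
    Σ (Perm n → Perm n) λ Φ →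
    ((π : Perm n) → InSep π →
    InSep (Φ π) ×
    (∀ i → Φ (Φ π) i ≡ π i) ×
    (∀ v → InLMAX (Φ π) v ⇔ InLMAX π v) ×
    (∀ v → InLMIN (Φ π) v ⇔ InLMIN π v) ×
    (∀ v → InDESB (Φ π) v ⇔ InDESB π v) ×
    comp (Φ π) ≡ iar π ×
    iar (Φ π) ≡ comp π) ×
    ((π : Perm n) → In312 π → In312 (Φ π))
theorem1p2 (suc m) _ = Φ ,
  (λ π sep → let _ , s = shape-of π (parseWord π) (sep-¬bad π sep) in
    Φ-sep π s , Φ-involutive π s ,
    Φ-record π s ⊕ (λ _ → refl) , Φ-record π s ⊖ (λ _ → refl) , Φ-desb π s , Φ-comp π s , Φ-iar π s) ,
  (λ π p312 → let _ , s = shape-of π (parseWord π) (312-¬bad π p312) in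
    Φ-312 π s (λ w sub → proj₂ p312 (312⇒contains π w sub)))
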